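{- Let $q$ be an odd prime power. There is a constant $c_q$, depending only on $q$, with $0.8414q \leq c_q \leq 0.9184q$, such that the following holds for all positive integers $n,k$: if $M_1, M_2 \in \mathbb{F}_q^{k\times k}$ are matrices such that $M_1$, $M_2$ and $M_1 - M_2$ are all invertible, and $A \subseteq (\mathbb{F}_q^n)^k$ contains no triple of distinct points of the form $\vec{x},\ \vec{x}+M_1\vec{d},\ \vec{x}+M_2\vec{d}$ with $\vec{x},\vec{d} \in (\mathbb{F}_q^n)^k$, then $|A| \leq 3\cdot c_q^{kn}$.
   Context: An element $\vec{x}\in(\mathbb{F}_q^n)^k$ is written as a column $(\vec{x}^{(1)},\dots,\vec{x}^{(k)})^T$ with $\vec{x}^{(i)}\in\mathbb{F}_q^n$, and a matrix $M\in\mathbb{F}_q^{k\times k}$ acts on it by $(M\vec{x})^{(j)}=\sum_{s=1}^k M_{j,s}\vec{x}^{(s)}$. The set of triples $\vec{x},\vec{x}+M_1\vec{d},\vec{x}+M_2\vec{d}$ (with the three points distinct) is called the three-point pattern generated by $M_1,M_2$; it is full-rank when $M_1,M_2,M_1-M_2$ are invertible. -}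

module Defs where

open import Level using (0ℓ)
open import Data.Nat as ℕ using (ℕ; zero; suc; _≥_)
open import Data.Nat.Primality using (Prime)
open import Data.Fin as Fin using (Fin; _≟_)
open import Relation.Nullary using (yes; no)
open import Data.Empty using (⊥)
open import Data.Vec as Vec using (Vec; lookup; tabulate)
open import Data.List using (List; length)
open import Data.List.Relation.Unary.Unique.Propositional using (Unique)
open import Data.List.Membership.Propositional using (_∈_)
open import Data.Product using (Σ; ∃; _×_; _,_)
open import Relation.Nullary using (¬_)
open import Relation.Binary.PropositionalEquality using (_≡_)
open import Function.Bundles using (_↔_)
open import Algebra.Bundles using (CommutativeRing)
open import Data.Rational as ℚ using (ℚ)

OddPrimePower : ℕ → Set
OddPrimePower q = Σ ℕ λ p → Σ ℕ λ m →
  Prime p × (¬ (p ≡ 2)) × (m ≥ 1) × (q ≡ p ℕ.^ m)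

record FiniteField (q : ℕ) : Set₁ where
  field
    commRing : CommutativeRing 0ℓ 0ℓ
  open CommutativeRing commRing public
  field
    ≈-is-≡   : ∀ {x y} → (x ≈ y) → x ≡ y
    ≡-is-≈   : ∀ {x y} → x ≡ y → (x ≈ y)
    0≢1      : ¬ (0# ≡ 1#)
    inverse  : ∀ x → ¬ (x ≡ 0#) → Σ Carrier λ y → x * y ≡ 1#
    enum     : Fin q ↔ Carrier

module FieldOps {q : ℕ} (F : FiniteField q) where
  open FiniteField F

  Σ[_] : (k : ℕ) → (Fin k → Carrier) → Carrier
  Σ[ zero ]  f = 0#
  Σ[ suc k ] f = f Fin.zero + Σ[ k ] (λ i → f (Fin.suc i))

  Mat : ℕ → Set
  Mat k = Fin k → Fin k → Carrier

  idMat : (k : ℕ) → Mat k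
  idMat k i j with i ≟ j
  ... | yes _ = 1#
  ... | no  _ = 0#

  _⊗_ : {k : ℕ} → Mat k → Mat k → Mat k
  _⊗_ {k} M N i j = Σ[ k ] (λ s → M i s * N s j)

  _⊖_ : {k : ℕ} → Mat k → Mat k → Mat k
  (M ⊖ N) i j = M i j - N i j

  Invertible : {k : ℕ} → Mat k → Set
  Invertible {k} M = Σ (Mat k) λ N →
    (∀ i j → (M ⊗ N) i j ≡ idMat k i j) × (∀ i j → (N ⊗ M) i j ≡ idMat k i j)

  Point : ℕ → ℕ → Set
  Point n k = Vec (Vec Carrier n) k

  act : {n k : ℕ} → Mat k → Point n k → Point n k
  act {n} {k} M x = tabulate λ j → tabulate λ t →
    Σ[ k ] (λ s → M j s * lookup (lookup x s) t)

  _⊕_ : {n k : ℕ} → Point n k → Point n k → Point n k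
  x ⊕ y = Vec.zipWith (Vec.zipWith _+_) x y

  -- A (given as a duplicate-free list of points) contains no triple of
  -- distinct points x, x + M₁ d, x + M₂ d.
  PatternFree : {n k : ℕ} → Mat k → Mat k → List (Point n k) → Set
  PatternFree {n} {k} M₁ M₂ A = ∀ (x d : Point n k) → ¬ (
    x ∈ A × (x ⊕ act M₁ d) ∈ A × (x ⊕ act M₂ d) ∈ A ×
    ¬ (x ≡ x ⊕ act M₁ d) × ¬ (x ≡ x ⊕ act M₂ d) ×
    ¬ (x ⊕ act M₁ d ≡ x ⊕ act M₂ d))

_^ℚ_ : ℚ → ℕ → ℚ
c ^ℚ zero  = ℚ.1ℚ
c ^ℚ suc n = c ℚ.* (c ^ℚ n)

{-# OPTIONS --safe #-}

-- The constant is c = 0.9184 q. Put Nᵢ = Mᵢ⁻¹. On a pattern-free set A the maps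
-- α = N₂ − N₁, β = N₁, γ = −N₂ satisfy α(x) + β(y) + γ(z) = 0 only for x = y = z, so with
-- P(t) = ∏_{e ≠ 0} (t − e) the tensor T(x,y,z) = ∏ᵢ P(α(x)ᵢ + β(y)ᵢ + γ(z)ᵢ) is diagonal on A³
-- with non-zero diagonal. Every monomial of T has degree at most (q−1)kn, hence degree at most
-- (q−1)kn/3 in one of x, y, z; so T is a sum of at most 3L slices, L being the number of
-- exponent vectors in [0,q−1]^kn of total degree at most (q−1)kn/3, and Gaussian elimination
-- shows |A| ≤ 3L (the slice rank argument of Tao).
-- For 0 < s ≤ 1, weighting an exponent i by s^(3i−(q−1)) gives L ≤ (Σ_{i<q} s^(3i−(q−1)))^kn.
-- With q = 2h + 1 and u = s^h, convexity bounds the inner sum by ((h+1)(u⁻² + u⁴))/2 + h u,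
-- which is at most 0.9184 q for s = 21/25 if h = 1 and for s = 1 − 1/(5h) if h ≥ 2.
module Submission where

open import Defs
open import Data.Empty using (⊥-elim)
open import Data.Fin as Fin using (Fin; zero; suc; punchIn; remQuot; combine)
open import Data.Fin.Properties using (any?; punchInᵢ≢i; punchIn-injective; remQuot-combine)
open import Data.List as List using (List; []; _∷_; _++_; length; map; filter; upTo; applyUpTo; cartesianProductWith)
open import Data.List.Properties using (length-map; length-++; length-tabulate; filter-notAll; map-++; map-∘; map-applyUpTo)
open import Data.List.Membership.Propositional using (_∈_)
open import Data.List.Membership.Propositional.Properties
open import Data.List.Relation.Unary.All as ListAll using ()
open import Data.List.Relation.Unary.AllPairs using ([]; _∷_)
open import Data.List.Relation.Unary.Any as Any using (here; there)
open import Data.List.Relation.Unary.Unique.Propositional using (Unique)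
open import Data.Nat as ℕ using (ℕ; zero; suc; z≤n; s≤s)
import Data.Nat.Properties as ℕ
open import Data.Nat.Divisibility using (divides)
open import Data.Nat.Primality using (Prime; prime⇒irreducible; ¬prime[1])
open import Data.Nat.Tactic.RingSolver using (solve-∀)
open import Data.Product using (Σ; _×_; _,_; ∃; proj₁; proj₂)
open import Data.Sum using (_⊎_; inj₁; inj₂)
open import Data.Vec as Vec using (Vec; []; _∷_; lookup; tabulate)
open import Data.Vec.Properties using (lookup-zipWith; lookup∘tabulate; tabulate∘lookup; tabulate-cong; ≡-dec)
open import Data.Vec.Relation.Unary.All using (All; []; _∷_)
open import Function using (_∘_; Inverse)
open import Function.Properties.Inverse using (↔⇒↣; ↔-sym)
open import Relation.Binary.PropositionalEquality as ≡ using (_≡_)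
open import Relation.Nullary using (¬_; Dec; yes; no; ¬?)
open import Relation.Nullary.Decidable using (via-injection; decidable-stable)
open import Relation.Unary using (Decidable)

-- Counting exponent vectors of low total degree.

module Counting where
  open import Data.Nat
  open import Data.Nat.Properties
  open import Data.Nat.ListAction using (sum)
  open import Data.Nat.ListAction.Properties using (sum-++)
  open import Data.Nat.Solver using (module +-*-Solver)
  open import Relation.Binary.PropositionalEquality

  -- geo P R m = Σ_{i ≤ m} Pⁱ Rᵐ⁻ⁱ
  geo : ℕ → ℕ → ℕ → ℕ
  geo P R zero = 1
  geo P R (suc m) = R ^ suc m + P * geo P R m

  -- The defining recursion peels off the pure power of `R`, this one the pure power of `P`; adding
  -- the two gives the symmetric step of the trapezoidal bound.
  geo-sucʳ : ∀ P R m → geo P R (suc m) ≡ P ^ suc m + R * geo P R m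
  geo-sucʳ P R zero = lemma P R
    where
    lemma : ∀ P R → R * 1 + P * 1 ≡ P * 1 + R * 1
    lemma = solve-∀
  geo-sucʳ P R (suc m) = begin
    R * R ^ suc m + P * geo P R (suc m)                ≡⟨ cong (λ t → R * R ^ suc m + P * t) (geo-sucʳ P R m) ⟩
    R * R ^ suc m + P * (P ^ suc m + R * geo P R m)    ≡⟨ lemma P R (P ^ suc m) (R ^ suc m) (geo P R m) ⟩
    P * P ^ suc m + R * (R ^ suc m + P * geo P R m)    ∎
    where
    open ≡-Reasoning
    lemma : ∀ P R a b g → R * b + P * (a + R * g) ≡ P * a + R * (b + P * g)
    lemma = solve-∀

  -- The sum is cut at index `a`. That index lies in both pieces, so its term is counted twice on
  -- the right and is added once on the left.
  geo-+ : ∀ P R a b → geo P R (a + b) + P ^ a * R ^ b ≡ R ^ b * geo P R a + P ^ a * geo P R b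
  geo-+ P R zero b = lemma (geo P R b) (R ^ b)
    where
    lemma : ∀ g r → g + 1 * r ≡ r * 1 + 1 * g
    lemma = solve-∀
  geo-+ P R (suc a) b = begin
    R * R ^ (a + b) + P * geo P R (a + b) + P * P ^ a * R ^ b
      ≡⟨ lemma₁ (R * R ^ (a + b)) P (geo P R (a + b)) (P ^ a) (R ^ b) ⟩
    R * R ^ (a + b) + P * (geo P R (a + b) + P ^ a * R ^ b)
      ≡⟨ cong₂ (λ s t → R * s + P * t) (^-distribˡ-+-* R a b) (geo-+ P R a b) ⟩
    R * (R ^ a * R ^ b) + P * (R ^ b * geo P R a + P ^ a * geo P R b)
      ≡⟨ lemma₂ P R (P ^ a) (R ^ a) (R ^ b) (geo P R a) (geo P R b) ⟩
    R ^ b * (R * R ^ a + P * geo P R a) + P * P ^ a * geo P R b ∎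
    where
    open ≡-Reasoning
    lemma₁ : ∀ s P g x y → s + P * g + P * x * y ≡ s + P * (g + x * y)
    lemma₁ = solve-∀
    lemma₂ : ∀ P R x y z g g′ → R * (y * z) + P * (z * g + x * g′) ≡ z * (R * y + P * g) + P * x * g′
    lemma₂ = solve-∀

  rearrangement : ∀ {a b c d} → a ≤ b → c ≤ d → a * d + b * c ≤ a * c + b * d
  rearrangement {a} {b} {c} {d} a≤b c≤d with m≤n⇒∃[o]m+o≡n a≤b | m≤n⇒∃[o]m+o≡n c≤d
  ... | x , refl | y , refl = begin
    a * (c + y) + (a + x) * c            ≤⟨ m≤m+n _ (x * y) ⟩
    a * (c + y) + (a + x) * c + x * y    ≡⟨ lemma a c x y ⟩
    a * c + (a + x) * (c + y)            ∎
    where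
    open ≤-Reasoning
    lemma : ∀ a c x y → a * (c + y) + (a + x) * c + x * y ≡ a * c + (a + x) * (c + y)
    lemma = solve-∀

  -- The trapezoidal bound for a convex sequence.
  geo-trapezoid : ∀ {P R} → P ≤ R → ∀ m → 2 * geo P R m ≤ suc m * (P ^ m + R ^ m)
  geo-trapezoid P≤R zero = ≤-refl
  geo-trapezoid {P} {R} P≤R (suc m) = *-cancelˡ-≤ 2 (begin
    2 * (2 * geo P R (suc m))
      ≡⟨ cong (λ t → 2 * (geo P R (suc m) + (t + 0))) (geo-sucʳ P R m) ⟩
    2 * (R ^ suc m + P * g + (P ^ suc m + R * g + 0))
      ≡⟨ lemma₁ P R (P ^ suc m) (R ^ suc m) g ⟩
    2 * (P ^ suc m + R ^ suc m) + (P + R) * (2 * g)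
      ≤⟨ +-monoʳ-≤ (2 * (P ^ suc m + R ^ suc m)) (*-monoʳ-≤ (P + R) (geo-trapezoid P≤R m)) ⟩
    2 * (P ^ suc m + R ^ suc m) + (P + R) * (suc m * (P ^ m + R ^ m))
      ≡⟨ lemma₂ P R (P ^ m) (R ^ m) m ⟩
    2 * (P ^ suc m + R ^ suc m) + suc m * (P * P ^ m + R * R ^ m + (P * R ^ m + R * P ^ m))
      ≤⟨ +-monoʳ-≤ (2 * (P ^ suc m + R ^ suc m)) (*-monoʳ-≤ (suc m)
           (+-monoʳ-≤ (P * P ^ m + R * R ^ m) (rearrangement P≤R (^-monoˡ-≤ m P≤R)))) ⟩
    2 * (P ^ suc m + R ^ suc m) + suc m * (P * P ^ m + R * R ^ m + (P * P ^ m + R * R ^ m))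
      ≡⟨ lemma₃ (P ^ suc m + R ^ suc m) m ⟩
    2 * (suc (suc m) * (P ^ suc m + R ^ suc m)) ∎)
    where
    open ≤-Reasoning
    g = geo P R m
    lemma₁ : ∀ P R a b g → 2 * (b + P * g + (a + R * g + 0)) ≡ 2 * (a + b) + (P + R) * (2 * g)
    lemma₁ = solve-∀
    lemma₂ : ∀ P R a b m → 2 * (P * a + R * b) + (P + R) * (suc m * (a + b))
                         ≡ 2 * (P * a + R * b) + suc m * (P * a + R * b + (P * b + R * a))
    lemma₂ = solve-∀
    lemma₃ : ∀ s m → 2 * s + suc m * (s + s) ≡ 2 * (suc (suc m) * s)
    lemma₃ = solve-∀

  -- The trapezoidal bound is applied to each half of the range. For P = p³, R = r³ and u = (p/r)^h,
  -- dividing by 2 u² r^(6h) and moving u to the right gives ((h+1)(u⁻² + u⁴))/2 + h u.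
  geo-double : ∀ {P R} → P ≤ R → ∀ h →
               2 * geo P R (h + h) + 2 * (P ^ h * R ^ h) ≤ suc h * ((P ^ h + R ^ h) * (P ^ h + R ^ h))
  geo-double {P} {R} P≤R h = begin
    2 * geo P R (h + h) + 2 * (P ^ h * R ^ h)      ≡⟨ *-distribˡ-+ 2 (geo P R (h + h)) _ ⟨
    2 * (geo P R (h + h) + P ^ h * R ^ h)          ≡⟨ cong (2 *_) (geo-+ P R h h) ⟩
    2 * (R ^ h * geo P R h + P ^ h * geo P R h)    ≡⟨ lemma₁ (P ^ h) (R ^ h) (geo P R h) ⟩
    (P ^ h + R ^ h) * (2 * geo P R h)              ≤⟨ *-monoʳ-≤ (P ^ h + R ^ h) (geo-trapezoid P≤R h) ⟩
    (P ^ h + R ^ h) * (suc h * (P ^ h + R ^ h))    ≡⟨ lemma₂ (P ^ h + R ^ h) h ⟩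
    suc h * ((P ^ h + R ^ h) * (P ^ h + R ^ h))    ∎
    where
    open ≤-Reasoning
    lemma₁ : ∀ a b g → 2 * (b * g + a * g) ≡ (a + b) * (2 * g)
    lemma₁ = solve-∀
    lemma₂ : ∀ s h → s * (suc h * s) ≡ suc h * (s * s)
    lemma₂ = solve-∀

  -- Bernoulli's inequality (1 - x)^j ≥ 1 - jx for x = d/(p+d), cleared of denominators and of
  -- subtraction.
  bernoulli-lower : ∀ p d j → (p + d) ^ j * (p + d) ≤ p ^ j * (p + d) + d * j * (p + d) ^ j
  bernoulli-lower p d zero = m≤m+n _ _
  bernoulli-lower p d (suc j) = begin
    r * r ^ j * r                                         ≡⟨ *-assoc r (r ^ j) r ⟩
    r * (r ^ j * r)                                       ≤⟨ *-monoʳ-≤ r (bernoulli-lower p d j) ⟩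
    r * (p ^ j * r + d * j * r ^ j)                       ≡⟨ lemma₁ p d j (p ^ j) (r ^ j) ⟩
    p * p ^ j * r + d * (p ^ j * r) + d * j * (r * r ^ j)
      ≤⟨ +-monoˡ-≤ _ (+-monoʳ-≤ (p * p ^ j * r) (*-monoʳ-≤ d (*-monoˡ-≤ r (^-monoˡ-≤ j (m≤m+n p d))))) ⟩
    p * p ^ j * r + d * (r ^ j * r) + d * j * (r * r ^ j) ≡⟨ lemma₂ (p * p ^ j * r) d j r (r ^ j) ⟩
    p * p ^ j * r + d * suc j * (r * r ^ j)               ∎
    where
    open ≤-Reasoning
    r = p + d
    lemma₁ : ∀ p d j x y → (p + d) * (x * (p + d) + d * j * y) ≡ p * x * (p + d) + d * (x * (p + d)) + d * j * ((p + d) * y)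
    lemma₁ = solve-∀
    lemma₂ : ∀ s d j r y → s + d * (y * r) + d * j * (r * y) ≡ s + d * suc j * (r * y)
    lemma₂ = solve-∀

  -- The companion (1 - x)^j ≤ 1/(1 + jx) for x = d/(p+d). The induction rests on (1 - x)(1 +
  -- (j+1)x) = 1 + jx - (j+1)x², whose last term is the slack `d * d * suc j`.
  bernoulli-upper : ∀ p d j → p ^ j * (p + d + d * j) ≤ (p + d) ^ j * (p + d)
  bernoulli-upper p d zero = ≤-reflexive (lemma p d)
    where
    lemma : ∀ p d → 1 * (p + d + d * 0) ≡ 1 * (p + d)
    lemma = solve-∀
  bernoulli-upper p d (suc j) = begin
    p * p ^ j * (r + d * suc j)                           ≤⟨ m≤m+n _ (p ^ j * (d * d * suc j)) ⟩
    p * p ^ j * (r + d * suc j) + p ^ j * (d * d * suc j) ≡⟨ lemma p d j (p ^ j) ⟩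
    r * (p ^ j * (r + d * j))                             ≤⟨ *-monoʳ-≤ r (bernoulli-upper p d j) ⟩
    r * (r ^ j * r)                                       ≡⟨ *-assoc r (r ^ j) r ⟨
    r * r ^ j * r                                         ∎
    where
    open ≤-Reasoning
    r = p + d
    lemma : ∀ p d j x → p * x * (p + d + d * suc j) + x * (d * d * suc j) ≡ (p + d) * (x * (p + d + d * j))
    lemma = solve-∀

  -- In terms of u = U/V: u³ + 1 ≤ 1.895 u on [4/5, 5/6]. The coordinates α = 5U − 4V and γ = 5V − 6U,
  -- which are non-negative exactly on this interval, make all coefficients of the difference positive.
  cubic : ∀ α γ → let U = 5 * α + 4 * γ; V = 6 * α + 5 * γ in
          200 * (U * U * U + V * V * V) ≤ 379 * (U * (V * V))
  cubic α γ = m+n≤o⇒m≤o _ (≤-reflexive (lemma α γ))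
    where
    open +-*-Solver
    lemma : ∀ α γ → let U = 5 * α + 4 * γ; V = 6 * α + 5 * γ in
      200 * (U * U * U + V * V * V)
        + (100 * (γ * γ * γ) + 335 * (γ * γ * α) + 276 * (γ * α * α) + 20 * (α * α * α))
      ≡ 379 * (U * (V * V))
    lemma = solve 2 (λ α γ → let U = con 5 :* α :+ con 4 :* γ; V = con 6 :* α :+ con 5 :* γ in
      con 200 :* (U :* U :* U :+ V :* V :* V)
        :+ (con 100 :* (γ :* γ :* γ) :+ con 335 :* (γ :* γ :* α) :+ con 276 :* (γ :* α :* α) :+ con 20 :* (α :* α :* α))
      := con 379 :* (U :* (V :* V))) refl

  -- An inequality affine in k follows from the case k = 0 and a comparison of slopes. It is used
  -- with k = h - 2, where 3 + k = h + 1 and 5 + 2k = q.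
  linear-bound : ∀ {a b c} → 3 * a ≤ b * 5 + c → a ≤ b * 2 → ∀ k → (3 + k) * a ≤ b * (5 + 2 * k) + c
  linear-bound {a} {b} {c} 3a≤ a≤ k = begin
    (3 + k) * a               ≡⟨ *-distribʳ-+ a 3 k ⟩
    3 * a + k * a             ≤⟨ +-mono-≤ 3a≤ (*-monoʳ-≤ k a≤) ⟩
    b * 5 + c + k * (b * 2)   ≡⟨ lemma b c k ⟩
    b * (5 + 2 * k) + c       ∎
    where
    open ≤-Reasoning
    lemma : ∀ b c k → b * 5 + c + k * (b * 2) ≡ b * (5 + 2 * k) + c
    lemma = solve-∀

  -- 143641 = 379², 73472 = 8 · 9184 and 64000 = 8 · 2000 · 4.
  weighted-square-bound : ∀ {a e} → a * 143641 ≤ 73472 * e + 64000 →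
    ∀ {S Z Y} → 200 * S ≤ 379 * Z → 4 * (Z * Z) ≤ 5 * Y →
    8 * (5000 * (a * (S * S))) ≤ 8 * (9184 * (e * (Z * Z)) + 10000 * Y)
  weighted-square-bound {a} {e} a≤e {S} {Z} {Y} S≤ Z≤ = begin
    8 * (5000 * (a * (S * S)))               ≡⟨ lemma₁ 8 5000 a (S * S) ⟩
    a * (40000 * (S * S))                    ≡⟨ cong (a *_) (lemma₂ 200 S) ⟩
    a * (200 * S * (200 * S))                ≤⟨ *-monoʳ-≤ a (*-mono-≤ S≤ S≤) ⟩
    a * (379 * Z * (379 * Z))                ≡⟨ cong (a *_) (lemma₂ 379 Z) ⟨
    a * (143641 * (Z * Z))                   ≡⟨ *-assoc a 143641 (Z * Z) ⟨
    a * 143641 * (Z * Z)                     ≤⟨ *-monoˡ-≤ (Z * Z) a≤e ⟩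
    (73472 * e + 64000) * (Z * Z)            ≡⟨ lemma₃ 8 9184 2000 4 e (Z * Z) ⟩
    8 * (9184 * (e * (Z * Z)) + 2000 * (4 * (Z * Z)))
      ≤⟨ *-monoʳ-≤ 8 (+-monoʳ-≤ (9184 * (e * (Z * Z))) (*-monoʳ-≤ 2000 Z≤)) ⟩
    8 * (9184 * (e * (Z * Z)) + 2000 * (5 * Y))
      ≡⟨ cong (λ t → 8 * (9184 * (e * (Z * Z)) + t)) (sym (*-assoc 2000 5 Y)) ⟩
    8 * (9184 * (e * (Z * Z)) + 10000 * Y) ∎
    where
    open ≤-Reasoning
    lemma₁ : ∀ a b c s → a * (b * (c * s)) ≡ c * (a * b * s)
    lemma₁ = solve-∀
    lemma₂ : ∀ a S → a * a * (S * S) ≡ a * S * (a * S)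
    lemma₂ = solve-∀
    lemma₃ : ∀ a b c d e x → (a * b * e + a * (c * d)) * x ≡ a * (b * (e * x) + c * (d * x))
    lemma₃ = solve-∀

  -- For u = U/V in [4/5, 5/6] the cubic inequality gives (u³ + 1)² ≤ 1.895² u², and u ≥ 4/5 gives
  -- u² ≤ (5/4) u³. Every term is thereby compared with u², and what remains is the linear
  -- hypothesis on `a` and `e`.
  squared-bound : ∀ {a e U V} → a * 143641 ≤ 73472 * e + 64000 → 4 * V ≤ 5 * U → 6 * U ≤ 5 * V →
    let S = U * U * U + V * V * V; Z = U * (V * V); Y = U * U * U * (V * V * V) in
    5000 * (a * (S * S)) ≤ 9184 * (e * (Z * Z)) + 10000 * Y
  squared-bound {a} {e} {U} {V} a≤e 4V≤5U 6U≤5V = *-cancelˡ-≤ 8 (weighted-square-bound {a} {e} a≤e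
      {U * U * U + V * V * V} {U * (V * V)} {U * U * U * (V * V * V)} S≤ 4X≤5Y)
    where
    open ≤-Reasoning
    -- The hypotheses make both truncated differences exact. The change of coordinates has
    -- determinant 1, so `U` and `V` are integer combinations of `α` and `γ`.
    α = 5 * U ∸ 4 * V
    γ = 5 * V ∸ 6 * U
    eqα = m+[n∸m]≡n 4V≤5U
    eqγ = m+[n∸m]≡n 6U≤5V
    U≡ : U ≡ 5 * α + 4 * γ
    U≡ = +-cancelˡ-≡ (24 * U + 20 * V) _ _ (trans (lemma₁ U V)
           (trans (sym (cong₂ (λ s t → 5 * s + 4 * t) eqα eqγ)) (lemma₂ U V α γ)))
      where
      lemma₁ : ∀ U V → 24 * U + 20 * V + U ≡ 5 * (5 * U) + 4 * (5 * V)
      lemma₁ = solve-∀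
      lemma₂ : ∀ U V α γ → 5 * (4 * V + α) + 4 * (6 * U + γ) ≡ 24 * U + 20 * V + (5 * α + 4 * γ)
      lemma₂ = solve-∀
    V≡ : V ≡ 6 * α + 5 * γ
    V≡ = +-cancelˡ-≡ (30 * U + 24 * V) _ _ (trans (lemma₁ U V)
           (trans (sym (cong₂ (λ s t → 6 * s + 5 * t) eqα eqγ)) (lemma₂ U V α γ)))
      where
      lemma₁ : ∀ U V → 30 * U + 24 * V + V ≡ 6 * (5 * U) + 5 * (5 * V)
      lemma₁ = solve-∀
      lemma₂ : ∀ U V α γ → 6 * (4 * V + α) + 5 * (6 * U + γ) ≡ 30 * U + 24 * V + (6 * α + 5 * γ)
      lemma₂ = solve-∀
    S≤ : 200 * (U * U * U + V * V * V) ≤ 379 * (U * (V * V))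
    S≤ = subst₂ (λ U V → 200 * (U * U * U + V * V * V) ≤ 379 * (U * (V * V)))
           {5 * α + 4 * γ} {U} {6 * α + 5 * γ} {V} (sym U≡) (sym V≡) (cubic α γ)
    4X≤5Y : 4 * (U * (V * V) * (U * (V * V))) ≤ 5 * (U * U * U * (V * V * V))
    4X≤5Y = begin
      4 * (U * (V * V) * (U * (V * V)))  ≡⟨ lemma₁ U V ⟩
      4 * V * (U * U * (V * V * V))      ≤⟨ *-monoˡ-≤ (U * U * (V * V * V)) 4V≤5U ⟩
      5 * U * (U * U * (V * V * V))      ≡⟨ lemma₂ U V ⟩
      5 * (U * U * U * (V * V * V))      ∎
      where
      lemma₁ : ∀ U V → 4 * (U * (V * V) * (U * (V * V))) ≡ 4 * V * (U * U * (V * V * V))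
      lemma₁ = solve-∀
      lemma₂ : ∀ U V → 5 * U * (U * U * (V * V * V)) ≡ 5 * (U * U * U * (V * V * V))
      lemma₂ = solve-∀

  -- The weight (P/R)^i scaled by R^B, which keeps it a natural number for i ≤ B.
  expWeight : ℕ → ℕ → ℕ → ℕ → ℕ
  expWeight P R B i = P ^ i * R ^ (B ∸ i)

  sum-expWeight : ∀ P R B → sum (applyUpTo (expWeight P R B) (suc B)) ≡ geo P R B
  sum-expWeight P R zero = refl
  sum-expWeight P R (suc B) = cong₂ _+_ (*-identityˡ (R ^ suc B))
    (trans (shift (suc B) (λ i → i)) (cong (P *_) (sum-expWeight P R B)))
    where
    shift : ∀ n (f : ℕ → ℕ) → sum (applyUpTo (λ i → expWeight P R (suc B) (suc (f i))) n)
          ≡ P * sum (applyUpTo (λ i → expWeight P R B (f i)) n)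
    shift zero f = sym (*-zeroʳ P)
    shift (suc n) f = trans (cong₂ _+_ (*-assoc P (P ^ f 0) _) (shift n (λ i → f (suc i))))
      (sym (*-distribˡ-+ P (expWeight P R B (f 0)) _))

  -- Both Bernoulli bounds for x = 1/(5h) and j = h. Since jx = 1/5 whatever h is, the power u = (1
  -- - 1/(5h))^h always lies between 1 - 1/5 = 4/5 and 1/(1 + 1/5) = 5/6.
  bernoulli-interval : ∀ h-1 → let h = suc h-1; U = (h-1 + 4 * h) ^ h; V = (5 * h) ^ h in
                       4 * V ≤ 5 * U × 6 * U ≤ 5 * V
  bernoulli-interval h-1 = *-cancelʳ-≤ _ _ h lower , *-cancelʳ-≤ _ _ h upper
    where
    open ≤-Reasoning
    h = suc h-1
    p = h-1 + 4 * h
    r = 5 * h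
    U = p ^ h
    V = r ^ h
    p+1≡r : p + 1 ≡ r
    p+1≡r = lemma h-1
      where
      lemma : ∀ k → k + 4 * suc k + 1 ≡ 5 * suc k
      lemma = solve-∀
    lower : 4 * V * h ≤ 5 * U * h
    lower = +-cancelʳ-≤ (1 * h * V) _ _ (begin
      4 * V * h + 1 * h * V  ≡⟨ lemma₁ V h ⟩
      V * r                  ≤⟨ subst (λ r → r ^ h * r ≤ U * r + 1 * h * r ^ h) p+1≡r (bernoulli-lower p 1 h) ⟩
      U * r + 1 * h * V      ≡⟨ cong (_+ 1 * h * V) (lemma₂ U h) ⟩
      5 * U * h + 1 * h * V  ∎)
      where
      lemma₁ : ∀ V h → 4 * V * h + 1 * h * V ≡ V * (5 * h)
      lemma₁ = solve-∀
      lemma₂ : ∀ U h → U * (5 * h) ≡ 5 * U * h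
      lemma₂ = solve-∀
    upper : 6 * U * h ≤ 5 * V * h
    upper = begin
      6 * U * h          ≡⟨ lemma₁ U h ⟩
      U * (r + 1 * h)    ≤⟨ subst (λ r → U * (r + 1 * h) ≤ r ^ h * r) p+1≡r (bernoulli-upper p 1 h) ⟩
      V * r              ≡⟨ lemma₂ V h ⟩
      5 * V * h          ∎
      where
      lemma₁ : ∀ U h → 6 * U * h ≡ U * (5 * h + 1 * h)
      lemma₁ = solve-∀
      lemma₂ : ∀ U h → U * (5 * h) ≡ 5 * U * h
      lemma₂ = solve-∀

  -- With u = (p/r)^h: (h+1)(u³ + 1)²/2 ≤ 0.9184 (2h+1) u² + u³.
  ScaleBound : ℕ → ℕ → ℕ → Set
  ScaleBound h p r =
    let U = p ^ h; V = r ^ h; S = U * U * U + V * V * V; Z = U * (V * V); Y = U * U * U * (V * V * V) in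
    5000 * (suc h * (S * S)) ≤ 9184 * (suc (h + h) * (Z * Z)) + 10000 * Y

  scale : ∀ h → 1 ≤ h → ∃ λ p → ∃ λ r → 1 ≤ p × p ≤ r × ScaleBound h p r
  -- For h = 1 the general ratio 1 - 1/(5h) = 4/5 violates the bound; 21/25 satisfies it by
  -- evaluation, with little to spare.
  scale (suc zero) _ = 21 , 25 , s≤s z≤n , ≤ᵇ⇒≤ 21 25 _ , ≤ᵇ⇒≤ _ _ _
  scale h@(suc h-1@(suc k)) _ = h-1 + 4 * h , 5 * h , s≤s z≤n , +-mono-≤ (n≤1+n h-1) ≤-refl ,
    squared-bound {suc h} {suc (h + h)} {(h-1 + 4 * h) ^ h} {(5 * h) ^ h}
      (subst (λ e → suc h * 143641 ≤ 73472 * e + 64000) (lemma k)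
         -- The case h = 2 is 3 · 143641 = 430923 ≤ 431360 = 5 · 73472 + 64000, and the slopes
         -- compare as 143641 ≤ 146944 = 2 · 73472.
         (linear-bound {143641} {73472} {64000} (≤ᵇ⇒≤ 430923 431360 _) (≤ᵇ⇒≤ 143641 146944 _) k))
      (proj₁ (bernoulli-interval h-1)) (proj₂ (bernoulli-interval h-1))
    where
    lemma : ∀ k → 5 + 2 * k ≡ suc (suc (suc k) + suc (suc k))
    lemma = solve-∀

  box : ℕ → (N : ℕ) → List (Vec ℕ N)
  box B zero    = [] ∷ []
  box B (suc N) = cartesianProductWith _∷_ (upTo (suc B)) (box B N)

  ∈-box⁺ : ∀ {B N} {e : Vec ℕ N} → All (_≤ B) e → e ∈ box B N
  ∈-box⁺ []       = here refl
  ∈-box⁺ (i≤B ∷ e≤B) = ∈-cartesianProductWith⁺ _∷_ (∈-upTo⁺ (s≤s i≤B)) (∈-box⁺ e≤B)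

  ∈-box⁻ : ∀ {B} N {e : Vec ℕ N} → e ∈ box B N → All (_≤ B) e
  ∈-box⁻ zero {[]} _ = []
  ∈-box⁻ {B} (suc N) e∈ with ∈-cartesianProductWith⁻ _∷_ (upTo (suc B)) (box B N) e∈
  ... | i , e , i∈ , e∈ , refl = s≤s⁻¹ (∈-upTo⁻ i∈) ∷ ∈-box⁻ N e∈

  IsLow : ℕ → ∀ {N} → Vec ℕ N → Set
  IsLow B {N} e = 3 * Vec.sum e ≤ N * B

  isLow? : ∀ B {N} → Decidable (IsLow B {N})
  isLow? B {N} e = 3 * Vec.sum e ≤? N * B

  low : ℕ → (N : ℕ) → List (Vec ℕ N)
  low B N = filter (isLow? B) (box B N)

  ∈-low⁺ : ∀ {B N} {e : Vec ℕ N} → All (_≤ B) e → IsLow B e → e ∈ low B N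
  ∈-low⁺ {B} e≤B low = ∈-filter⁺ (isLow? B) (∈-box⁺ e≤B) low

  weight : (ℕ → ℕ) → ∀ {N} → Vec ℕ N → ℕ
  weight f []      = 1
  weight f (i ∷ e) = f i * weight f e

  sum-map-* : ∀ {A : Set} c (f : A → ℕ) xs → sum (map (λ x → c * f x) xs) ≡ c * sum (map f xs)
  sum-map-* c f []       = sym (*-zeroʳ c)
  sum-map-* c f (x ∷ xs) = trans (cong (c * f x +_) (sum-map-* c f xs)) (sym (*-distribˡ-+ c (f x) _))

  sum-weight-product : ∀ f {N} is (es : List (Vec ℕ N)) →
    sum (map (weight f) (cartesianProductWith _∷_ is es)) ≡ sum (map f is) * sum (map (weight f) es)
  sum-weight-product f []       es = refl
  sum-weight-product f (i ∷ is) es = begin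
    sum (map (weight f) (map (i ∷_) es ++ rest))
      ≡⟨ cong sum (map-++ (weight f) (map (i ∷_) es) rest) ⟩
    sum (map (weight f) (map (i ∷_) es) ++ map (weight f) rest)
      ≡⟨ sum-++ (map (weight f) (map (i ∷_) es)) _ ⟩
    sum (map (weight f) (map (i ∷_) es)) + sum (map (weight f) rest)
      ≡⟨ cong₂ _+_ (trans (cong sum (sym (map-∘ es))) (sum-map-* (f i) (weight f) es)) (sum-weight-product f is es) ⟩
    f i * sum (map (weight f) es) + sum (map f is) * sum (map (weight f) es)
      ≡⟨ *-distribʳ-+ (sum (map (weight f) es)) (f i) _ ⟨
    (f i + sum (map f is)) * sum (map (weight f) es) ∎
    where
    open ≡-Reasoning
    rest = cartesianProductWith _∷_ is es

  -- Weights multiply over the coordinates, so the sum over the box factorises into equal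
  -- one-coordinate sums.
  sum-weight-box : ∀ f B N → sum (map (weight f) (box B N)) ≡ sum (map f (upTo (suc B))) ^ N
  sum-weight-box f B zero    = refl
  sum-weight-box f B (suc N) = trans (sum-weight-product f (upTo (suc B)) (box B N))
    (cong (sum (map f (upTo (suc B))) *_) (sum-weight-box f B N))

  -- Markov's inequality. The lower bound is asked only of members of `xs`, because the weight
  -- estimate is available for exponents inside the box.
  markov : ∀ {A : Set} {P : A → Set} (P? : Decidable P) (f : A → ℕ) K xs →
           (∀ {x} → x ∈ xs → P x → K ≤ f x) → length (filter P? xs) * K ≤ sum (map f xs)
  markov P? f K []       K≤f = z≤n
  markov P? f K (x ∷ xs) K≤f with P? x
  ... | yes px = +-mono-≤ (K≤f (here refl) px) (markov P? f K xs (λ x∈ → K≤f (there x∈)))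
  ... | no  _  = ≤-trans (markov P? f K xs (λ x∈ → K≤f (there x∈))) (m≤n+m _ (f x))

  -- The factor `R ^ Vec.sum e` completes each `R ^ (B ∸ i)` to `R ^ B`, so the right side is free
  -- of truncated differences.
  weight-expWeight : ∀ P R {B N} {e : Vec ℕ N} → All (_≤ B) e →
             weight (expWeight P R B) e * R ^ Vec.sum e ≡ P ^ Vec.sum e * R ^ (N * B)
  weight-expWeight P R []                              = refl
  weight-expWeight P R {B} {suc N} {i ∷ e} (i≤B ∷ e≤B) = begin
    P ^ i * R ^ (B ∸ i) * weight (expWeight P R B) e * R ^ (i + Vec.sum e)
      ≡⟨ cong (P ^ i * R ^ (B ∸ i) * weight (expWeight P R B) e *_) (^-distribˡ-+-* R i _) ⟩
    P ^ i * R ^ (B ∸ i) * weight (expWeight P R B) e * (R ^ i * R ^ Vec.sum e)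
      ≡⟨ lemma (P ^ i) (R ^ (B ∸ i)) (weight (expWeight P R B) e) (R ^ i) (R ^ Vec.sum e) ⟩
    P ^ i * (R ^ (B ∸ i) * R ^ i) * (weight (expWeight P R B) e * R ^ Vec.sum e)
      ≡⟨ cong₂ (λ s t → P ^ i * s * t) (trans (sym (^-distribˡ-+-* R (B ∸ i) i)) (cong (R ^_) (m∸n+n≡m i≤B))) (weight-expWeight P R e≤B) ⟩
    P ^ i * R ^ B * (P ^ Vec.sum e * R ^ (N * B))
      ≡⟨ [m*n]*[o*p]≡[m*o]*[n*p] (P ^ i) (R ^ B) (P ^ Vec.sum e) _ ⟩
    P ^ i * P ^ Vec.sum e * (R ^ B * R ^ (N * B))
      ≡⟨ cong₂ _*_ (^-distribˡ-+-* P i _) (^-distribˡ-+-* R B _) ⟨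
    P ^ (i + Vec.sum e) * R ^ (B + N * B) ∎
    where
    open ≡-Reasoning
    lemma : ∀ a b c d e → a * b * c * (d * e) ≡ a * (b * d) * (c * e)
    lemma = solve-∀

  ^-distribʳ-* : ∀ n x y → (x * y) ^ n ≡ x ^ n * y ^ n
  ^-distribʳ-* zero    x y = refl
  ^-distribʳ-* (suc n) x y = trans (cong (x * y *_) (^-distribʳ-* n x y)) ([m*n]*[o*p]≡[m*o]*[n*p] x y (x ^ n) (y ^ n))

  cube-^ : ∀ p n → (p * p * p) ^ n ≡ p ^ n * p ^ n * p ^ n
  cube-^ p n = trans (^-distribʳ-* n (p * p) p) (cong (_* p ^ n) (^-distribʳ-* n p p))

  cube-^′ : ∀ p n → (p * p * p) ^ n ≡ p ^ (3 * n)
  cube-^′ p n = trans (cong (λ t → (p * p * t) ^ n) (sym (*-identityʳ p)))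
    (trans (cong (_^ n) (*-assoc p p (p * 1))) (^-*-assoc p 3 n))

  -- With total degree s and M = N · B the weight is p^(3s) r^(3M-3s). As 3s ≤ M, replacing M - 3s
  -- factors `r` by the smaller `p` leaves p^M r^(2M). Dividing by this quantity is the
  -- normalisation to weights s^(3i-(q-1)), under which low vectors weigh at least 1.
  low-weight : ∀ {p r} → 1 ≤ p → p ≤ r → ∀ {B N} {e : Vec ℕ N} → All (_≤ B) e → IsLow B e →
               (p ^ B * (r ^ B * r ^ B)) ^ N ≤ weight (expWeight (p * p * p) (r * r * r) B) e
  low-weight {p} {r} 1≤p p≤r {B} {N} {e} e≤B low = *-cancelʳ-≤ _ _ (R ^ s) ⦃ m^n≢0 R s ⦃ R≢0 ⦄ ⦄ (begin
    (p ^ B * (r ^ B * r ^ B)) ^ N * R ^ s            ≡⟨ cong₂ _*_ distribute (cube-^′ r s) ⟩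
    p ^ M * (r ^ M * r ^ M) * r ^ S                  ≡⟨ cong (λ t → t * (r ^ M * r ^ M) * r ^ S) (split p) ⟩
    p ^ S * p ^ t * (r ^ M * r ^ M) * r ^ S
      ≤⟨ *-monoˡ-≤ (r ^ S) (*-monoˡ-≤ (r ^ M * r ^ M) (*-monoʳ-≤ (p ^ S) (^-monoˡ-≤ t p≤r))) ⟩
    p ^ S * r ^ t * (r ^ M * r ^ M) * r ^ S          ≡⟨ lemma (p ^ S) (r ^ t) (r ^ M) (r ^ S) ⟩
    p ^ S * (r ^ M * r ^ M * (r ^ S * r ^ t))        ≡⟨ cong (λ u → p ^ S * (r ^ M * r ^ M * u)) (split r) ⟨
    p ^ S * (r ^ M * r ^ M * r ^ M)                  ≡⟨ cong₂ _*_ (cube-^′ p s) (cube-^ r M) ⟨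
    P ^ s * R ^ M                                    ≡⟨ weight-expWeight P R e≤B ⟨
    weight (expWeight P R B) e * R ^ s               ∎)
    where
    open ≤-Reasoning
    P = p * p * p
    R = r * r * r
    s = Vec.sum e
    S = 3 * s
    M = N * B
    t = M ∸ S
    R≢0 : NonZero R
    R≢0 = >-nonZero (*-mono-≤ (*-mono-≤ 1≤r 1≤r) 1≤r)
      where 1≤r = ≤-trans 1≤p p≤r
    split : ∀ x → x ^ M ≡ x ^ S * x ^ t
    split x = trans (cong (x ^_) (sym (m+[n∸m]≡n low))) (^-distribˡ-+-* x S t)
    power : ∀ x → (x ^ B) ^ N ≡ x ^ M
    power x = trans (^-*-assoc x B N) (cong (x ^_) (*-comm B N))
    distribute : (p ^ B * (r ^ B * r ^ B)) ^ N ≡ p ^ M * (r ^ M * r ^ M)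
    distribute = trans (^-distribʳ-* N (p ^ B) _) (cong₂ _*_ (power p)
      (trans (^-distribʳ-* N (r ^ B) _) (cong₂ _*_ (power r) (power r))))
    lemma : ∀ a b c d → a * b * (c * c) * d ≡ a * (c * c * (d * b))
    lemma = solve-∀

  -- With s = p/r and q = 2h + 1: Σ_{i<q} s³ⁱ ≤ 0.9184 q s^(q−1).
  geo-bound : ∀ h p r → p ≤ r → ScaleBound h p r →
    10000 * geo (p * p * p) (r * r * r) (h + h)
      ≤ 9184 * suc (h + h) * (p ^ (h + h) * (r ^ (h + h) * r ^ (h + h)))
  geo-bound h p r p≤r bound = +-cancelʳ-≤ (10000 * Y) _ _ (begin
    10000 * G + 10000 * Y                ≡⟨ lemma₁ 5000 G Y ⟩
    5000 * (2 * G + 2 * Y)               ≤⟨ *-monoʳ-≤ 5000 double ⟩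
    5000 * (suc h * (S * S))             ≤⟨ bound ⟩
    9184 * (suc (h + h) * (Z * Z)) + 10000 * Y ≡⟨ cong (_+ 10000 * Y) (*-assoc 9184 (suc (h + h)) (Z * Z)) ⟨
    9184 * suc (h + h) * (Z * Z) + 10000 * Y ≡⟨ cong (λ t → 9184 * suc (h + h) * t + 10000 * Y) Z²≡ ⟩
    9184 * suc (h + h) * (p ^ (h + h) * (r ^ (h + h) * r ^ (h + h))) + 10000 * Y ∎)
    where
    open ≤-Reasoning
    U = p ^ h
    V = r ^ h
    S = U * U * U + V * V * V
    Z = U * (V * V)
    Y = U * U * U * (V * V * V)
    G = geo (p * p * p) (r * r * r) (h + h)
    double : 2 * G + 2 * Y ≤ suc h * (S * S)
    double = subst₂ (λ a b → 2 * G + 2 * (a * b) ≤ suc h * ((a + b) * (a + b))) (cube-^ p h) (cube-^ r h)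
      (geo-double (*-mono-≤ (*-mono-≤ p≤r p≤r) p≤r) h)
    lemma₁ : ∀ a G Y → a * 2 * G + a * 2 * Y ≡ a * (2 * G + 2 * Y)
    lemma₁ = solve-∀
    lemma₂ : ∀ U V → U * (V * V) * (U * (V * V)) ≡ U * U * (V * V * (V * V))
    lemma₂ = solve-∀
    Z²≡ : Z * Z ≡ p ^ (h + h) * (r ^ (h + h) * r ^ (h + h))
    Z²≡ = trans (lemma₂ U V) (sym (cong₂ _*_ (^-distribˡ-+-* p h h)
      (cong₂ _*_ (^-distribˡ-+-* r h h) (^-distribˡ-+-* r h h))))

  -- Markov's inequality over the box with threshold `K ^ N`; the one-coordinate weight sum is a
  -- value of `geo`, and the positive factor `K ^ N` cancels at the end.
  low-count-scaled : ∀ h p r → 1 ≤ p → p ≤ r → ScaleBound h p r → ∀ N →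
    length (low (h + h) N) * 10000 ^ N ≤ (9184 * suc (h + h)) ^ N
  low-count-scaled h p r 1≤p p≤r bound N = *-cancelʳ-≤ _ _ (K ^ N) ⦃ m^n≢0 K N ⦃ K≢0 ⦄ ⦄ (begin
    length (low B N) * D ^ N * K ^ N      ≡⟨ lemma (length (low B N)) (D ^ N) (K ^ N) ⟩
    D ^ N * (length (low B N) * K ^ N)    ≤⟨ *-monoʳ-≤ (D ^ N) (markov (isLow? B) (weight f) (K ^ N) (box B N)
                                                (λ e∈ low → low-weight 1≤p p≤r (∈-box⁻ N e∈) low)) ⟩
    D ^ N * sum (map (weight f) (box B N)) ≡⟨ cong (D ^ N *_) (trans (sum-weight-box f B N) (cong (_^ N) f≡geo)) ⟩
    D ^ N * G ^ N                         ≡⟨ ^-distribʳ-* N D G ⟨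
    (D * G) ^ N                           ≤⟨ ^-monoˡ-≤ N (geo-bound h p r p≤r bound) ⟩
    (C * K) ^ N                           ≡⟨ ^-distribʳ-* N C K ⟩
    C ^ N * K ^ N                         ∎)
    where
    open ≤-Reasoning
    B = h + h
    D = 10000
    C = 9184 * suc B
    K = p ^ B * (r ^ B * r ^ B)
    G = geo (p * p * p) (r * r * r) B
    f = expWeight (p * p * p) (r * r * r) B
    f≡geo : sum (map f (upTo (suc B))) ≡ G
    f≡geo = trans (cong sum (map-applyUpTo (λ i → i) f (suc B))) (sum-expWeight _ _ B)
    K≢0 : NonZero K
    K≢0 = m*n≢0 _ _ ⦃ pos p ⦃ >-nonZero 1≤p ⦄ ⦄ ⦃ m*n≢0 _ _ ⦃ r≢ ⦄ ⦃ r≢ ⦄ ⦄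
      where
      pos : ∀ x → .⦃ NonZero x ⦄ → NonZero (x ^ B)
      pos x = m^n≢0 x B
      r≢ : NonZero (r ^ B)
      r≢ = pos r ⦃ >-nonZero (≤-trans 1≤p p≤r) ⦄
    lemma : ∀ a b c → a * b * c ≡ b * (a * c)
    lemma = solve-∀

  low-count : ∀ h → 1 ≤ h → ∀ N → length (low (h + h) N) * 10000 ^ N ≤ (9184 * suc (h + h)) ^ N
  low-count h 1≤h N =
    let p , r , 1≤p , p≤r , bound = scale h 1≤h in low-count-scaled h p r 1≤p p≤r bound N

open Counting using (low; ∈-low⁺; low-count)

-- Decidable equality and absence of zero divisors in a finite field.

module Field {q : ℕ} (F : FiniteField q) where
  open FiniteField F public hiding (zero)
  open import Algebra.Solver.Ring.NaturalCoefficients.Default commutativeSemiring public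
    using (solve; _:=_; _:+_; _:*_; con)
  open import Relation.Binary.Reasoning.Setoid setoid

  _≟_ : (x y : Carrier) → Dec (x ≡ y)
  _≟_ = via-injection (↔⇒↣ (↔-sym enum)) Fin._≟_

  _≉0 : Carrier → Set
  x ≉0 = ¬ (x ≈ 0#)

  _≈0? : (x : Carrier) → Dec (x ≈ 0#)
  x ≈0? with x ≟ 0#
  ... | yes eq = yes (≡-is-≈ eq)
  ... | no neq = no (λ eq → neq (≈-is-≡ eq))

  inverse-≈ : ∀ {x} → x ≉0 → ∃ λ y → x * y ≈ 1#
  inverse-≈ x≉0 with inverse _ (λ eq → x≉0 (≡-is-≈ eq))
  ... | y , eq = y , ≡-is-≈ eq

  1≉0 : 1# ≉0
  1≉0 eq = 0≢1 (≡.sym (≈-is-≡ eq))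

  *-≉0 : ∀ {x y} → x ≉0 → y ≉0 → (x * y) ≉0
  *-≉0 {x} {y} x≉0 y≉0 xy≈0 with inverse-≈ x≉0
  ... | x⁻¹ , xx⁻¹≈1 = y≉0 (begin
    y              ≈⟨ *-identityʳ y ⟨
    y * 1#         ≈⟨ *-congˡ xx⁻¹≈1 ⟨
    y * (x * x⁻¹)  ≈⟨ solve 3 (λ x y i → y :* (x :* i) := x :* y :* i) refl x y x⁻¹ ⟩
    x * y * x⁻¹    ≈⟨ *-congʳ xy≈0 ⟩
    0# * x⁻¹       ≈⟨ zeroˡ _ ⟩
    0#             ∎)

-- Slice rank of diagonal tensors.

module SliceRank {q : ℕ} (F : FiniteField q) where
  open Field F
  open import Relation.Binary.Reasoning.Setoid setoid

  Tensor : Set → Set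
  Tensor X = X → X → X → Carrier

  data Axis : Set where
    ax₁ ax₂ ax₃ : Axis

  -- The cofactor takes its two arguments in cyclic order, so that a rotation of the axes carries
  -- slices to slices with the same `g`.
  slice : {X : Set} → Axis → (X → Carrier) → (X → X → Carrier) → Tensor X
  slice ax₁ f g x y z = f x * g y z
  slice ax₂ f g x y z = f y * g z x
  slice ax₃ f g x y z = f z * g x y

  -- The list fixes the axis and the one-variable factor of each slice, while the two-variable
  -- cofactors stay free. The length of the list therefore bounds the slice rank.
  data Span {X : Set} : List (Axis × (X → Carrier)) → Tensor X → Set where
    nil  : ∀ {T} → (∀ x y z → T x y z ≈ 0#) → Span [] T
    cons : ∀ {d f L T} g T′ → Span L T′ → (∀ x y z → T x y z ≈ slice d f g x y z + T′ x y z) →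
           Span ((d , f) ∷ L) T

  Span-resp : ∀ {X : Set} {L} {T T′ : Tensor X} → (∀ x y z → T′ x y z ≈ T x y z) → Span L T → Span L T′
  Span-resp T′≈T (nil T≈0) = nil λ x y z → trans (T′≈T x y z) (T≈0 x y z)
  Span-resp T′≈T (cons g S s eq) = cons g S s λ x y z → trans (T′≈T x y z) (eq x y z)

  slice-+ : ∀ {X : Set} d (f : X → Carrier) g g′ x y z →
    slice d f g x y z + slice d f g′ x y z ≈ slice d f (λ u v → g u v + g′ u v) x y z
  slice-+ ax₁ f g g′ x y z = sym (distribˡ _ _ _)
  slice-+ ax₂ f g g′ x y z = sym (distribˡ _ _ _)
  slice-+ ax₃ f g g′ x y z = sym (distribˡ _ _ _)

  slice-0 : ∀ {X : Set} d (f : X → Carrier) x y z → slice d f (λ _ _ → 0#) x y z ≈ 0#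
  slice-0 ax₁ f x y z = zeroʳ _
  slice-0 ax₂ f x y z = zeroʳ _
  slice-0 ax₃ f x y z = zeroʳ _

  Span-0 : ∀ {X : Set} L {T : Tensor X} → (∀ x y z → T x y z ≈ 0#) → Span L T
  Span-0 []            T≈0 = nil T≈0
  Span-0 ((d , f) ∷ L) T≈0 = cons (λ _ _ → 0#) (λ _ _ _ → 0#) (Span-0 L λ _ _ _ → refl) λ x y z →
    trans (T≈0 x y z) (sym (trans (+-identityʳ _) (slice-0 d f x y z)))

  -- Adding the cofactors of equal one-variable factors costs no new slice. This is how the many
  -- monomials of the tensor are gathered into few slices.
  Span-+ : ∀ {X : Set} {L} {T T′ : Tensor X} → Span L T → Span L T′ → Span L (λ x y z → T x y z + T′ x y z)
  Span-+ (nil T≈0) (nil T′≈0) = nil λ x y z → trans (+-cong (T≈0 x y z) (T′≈0 x y z)) (+-identityˡ 0#)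
  Span-+ {T = T} {T′} (cons {d} {f} g S s eq) (cons g′ S′ s′ eq′) =
    cons (λ u v → g u v + g′ u v) _ (Span-+ s s′) λ x y z → begin
      T x y z + T′ x y z
        ≈⟨ +-cong (eq x y z) (eq′ x y z) ⟩
      (slice d f g x y z + S x y z) + (slice d f g′ x y z + S′ x y z)
        ≈⟨ solve 4 (λ a b c d → (a :+ b) :+ (c :+ d) := (a :+ c) :+ (b :+ d)) refl
             (slice d f g x y z) (S x y z) (slice d f g′ x y z) (S′ x y z) ⟩
      (slice d f g x y z + slice d f g′ x y z) + (S x y z + S′ x y z)
        ≈⟨ +-congʳ (slice-+ d f g g′ x y z) ⟩
      slice d f (λ u v → g u v + g′ u v) x y z + (S x y z + S′ x y z) ∎

  Span-slice : ∀ {X : Set} {L} {d} {f : X → Carrier} → (d , f) ∈ L → ∀ g → Span L (slice d f g)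
  Span-slice {L = _ ∷ L} (here ≡.refl) g =
    cons g (λ _ _ _ → 0#) (Span-0 L λ _ _ _ → refl) λ x y z → sym (+-identityʳ _)
  Span-slice {L = (d , f) ∷ _} (there df∈) g = cons (λ _ _ → 0#) _ (Span-slice df∈ g) λ x y z →
    sym (trans (+-congʳ (slice-0 d f x y z)) (+-identityˡ _))

  rotate : {X : Set} → Tensor X → Tensor X
  rotate T x y z = T y z x

  rotateAxis : {X : Set} → Axis × (X → Carrier) → Axis × (X → Carrier)
  rotateAxis (ax₁ , f) = ax₂ , f
  rotateAxis (ax₂ , f) = ax₃ , f
  rotateAxis (ax₃ , f) = ax₁ , f

  Span-rotate : ∀ {X : Set} {L} {T : Tensor X} → Span L T → Span (List.map rotateAxis L) (rotate T)
  Span-rotate (nil T≈0)                = nil λ x y z → T≈0 y z x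
  Span-rotate (cons {ax₁} g T′ s eq) = cons g (rotate T′) (Span-rotate s) λ x y z → eq y z x
  Span-rotate (cons {ax₂} g T′ s eq) = cons g (rotate T′) (Span-rotate s) λ x y z → eq y z x
  Span-rotate (cons {ax₃} g T′ s eq) = cons g (rotate T′) (Span-rotate s) λ x y z → eq y z x

  -- One step of Gaussian elimination along the first axis with pivot x₀, followed by pulling
  -- back along p.
  module Elimination {X Y : Set} (p : Y → X) (x₀ : X) (a : X → Carrier) where
    reduce : Tensor X → Tensor Y
    reduce T x y z = T (p x) (p y) (p z) + a (p x) * T x₀ (p y) (p z)

    reduceAxis : Axis × (X → Carrier) → Axis × (Y → Carrier)
    reduceAxis (ax₁ , f) = ax₁ , λ x → f (p x) + a (p x) * f x₀
    reduceAxis (ax₂ , f) = ax₂ , λ y → f (p y)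
    reduceAxis (ax₃ , f) = ax₃ , λ z → f (p z)

    reduceCo : Axis → (X → X → Carrier) → (Y → Y → Carrier)
    reduceCo ax₁ g y z = g (p y) (p z)
    reduceCo ax₂ g z x = g (p z) (p x) + a (p x) * g (p z) x₀
    reduceCo ax₃ g x y = g (p x) (p y) + a (p x) * g x₀ (p y)

    -- The row operation touches only the first argument. It is absorbed by `f` for slices along the
    -- first axis and by the cofactor for the others, so one slice stays one slice.
    reduce-slice : ∀ d f g x y z → reduce (slice d f g) x y z
      ≈ slice (proj₁ (reduceAxis (d , f))) (proj₂ (reduceAxis (d , f))) (reduceCo d g) x y z
    reduce-slice ax₁ f g x y z = solve 4 (λ u v w t → u :* v :+ w :* (t :* v) := (u :+ w :* t) :* v) refl _ _ _ _
    reduce-slice ax₂ f g x y z = solve 4 (λ u v w t → u :* v :+ w :* (u :* t) := u :* (v :+ w :* t)) refl _ _ _ _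
    reduce-slice ax₃ f g x y z = solve 4 (λ u v w t → u :* v :+ w :* (u :* t) := u :* (v :+ w :* t)) refl _ _ _ _

    Span-reduce : ∀ {L T} → Span L T → Span (List.map reduceAxis L) (reduce T)
    Span-reduce (nil T≈0) = nil λ x y z → trans (+-cong (T≈0 _ _ _) (*-congˡ (T≈0 _ _ _)))
      (trans (+-identityˡ _) (zeroʳ _))
    Span-reduce {T = T} (cons {d} {f} g T′ s eq) = cons (reduceCo d g) (reduce T′) (Span-reduce s) λ x y z → begin
      T (p x) (p y) (p z) + a (p x) * T x₀ (p y) (p z)
        ≈⟨ +-cong (eq _ _ _) (*-congˡ (eq _ _ _)) ⟩
      (slice d f g (p x) (p y) (p z) + T′ (p x) (p y) (p z)) + a (p x) * (slice d f g x₀ (p y) (p z) + T′ x₀ (p y) (p z))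
        ≈⟨ solve 5 (λ s t a s′ t′ → (s :+ t) :+ a :* (s′ :+ t′) := (s :+ a :* s′) :+ (t :+ a :* t′)) refl _ _ _ _ _ ⟩
      reduce (slice d f g) x y z + reduce T′ x y z
        ≈⟨ +-congʳ (reduce-slice d f g x y z) ⟩
      slice (proj₁ (reduceAxis (d , f))) (proj₂ (reduceAxis (d , f))) (reduceCo d g) x y z + reduce T′ x y z ∎

  record Diagonal {X : Set} (T : Tensor X) : Set where
    field
      off : ∀ x y z → ¬ (x ≡ y × y ≡ z) → T x y z ≈ 0#
      on  : ∀ x → T x x x ≉0
  open Diagonal

  rotate-Diagonal : ∀ {X : Set} {T : Tensor X} → Diagonal T → Diagonal (rotate T)
  off (rotate-Diagonal D) x y z neq = off D y z x λ { (≡.refl , ≡.refl) → neq (≡.refl , ≡.refl) }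
  on  (rotate-Diagonal D) x = on D x

  -- The size, the list and the tensor are all quantified, since elimination shrinks the index set
  -- and rewrites the slices, and rotation permutes the axes.
  RankBound : ℕ → Set
  RankBound r = ∀ {m} {L} {T : Tensor (Fin m)} → length L ≡ r → Span L T → Diagonal T → m ℕ.≤ r

  -- If `f` vanishes, its slice drops out. Otherwise a row operation with a pivot where `f` is
  -- non-zero kills the slice, and deleting the pivot index on all three axes leaves a diagonal
  -- tensor of size one less.
  eliminate : ∀ {r} → RankBound r → ∀ {m f L} {T : Tensor (Fin m)} → length L ≡ r →
              Span ((ax₁ , f) ∷ L) T → Diagonal T → m ℕ.≤ suc r
  eliminate IH {f = f} {T = T} len (cons g T′ s eq) D with any? (λ i → ¬? (f i ≈0?))
  ... | no ∄ = ℕ.m≤n⇒m≤1+n (IH len (Span-resp drop s) D)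
    where
    f≈0 : ∀ x → f x ≈ 0#
    f≈0 x = decidable-stable (f x ≈0?) λ fx≉0 → ∄ (x , fx≉0)
    drop : ∀ x y z → T x y z ≈ T′ x y z
    drop x y z = trans (eq x y z) (trans (+-congʳ (trans (*-congʳ (f≈0 x)) (zeroˡ _))) (+-identityˡ _))
  eliminate IH {suc m} {f} {L} {T} len (cons g T′ s eq) D | yes (x₀ , fx₀≉0) =
    s≤s (IH (≡.trans (length-map reduceAxis L) len) (Span-resp kill (Span-reduce s)) reduced)
    where
    -- The multiplier is -1/f(x₀), which makes f(x) + c f(x) f(x₀) = 0 for every x.
    c : Carrier
    c = - proj₁ (inverse-≈ fx₀≉0)
    1+cf≈0 : 1# + c * f x₀ ≈ 0#
    1+cf≈0 = begin
      1# + c * f x₀                                      ≈⟨ +-congʳ (trans (*-comm _ _) (proj₂ (inverse-≈ fx₀≉0))) ⟨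
      proj₁ (inverse-≈ fx₀≉0) * f x₀ + c * f x₀          ≈⟨ distribʳ _ _ _ ⟨
      (proj₁ (inverse-≈ fx₀≉0) + c) * f x₀               ≈⟨ *-congʳ (-‿inverseʳ _) ⟩
      0# * f x₀                                          ≈⟨ zeroˡ _ ⟩
      0#                                                 ∎
    open Elimination (punchIn x₀) x₀ (λ x → c * f x)
    kill : ∀ x y z → reduce T x y z ≈ reduce T′ x y z
    kill x y z = begin
      T x′ y′ z′ + c * f x′ * T x₀ y′ z′
        ≈⟨ +-cong (eq _ _ _) (*-congˡ (eq _ _ _)) ⟩
      (f x′ * g y′ z′ + T′ x′ y′ z′) + c * f x′ * (f x₀ * g y′ z′ + T′ x₀ y′ z′)
        ≈⟨ solve 6 (λ u v s c w t → (u :* v :+ s) :+ c :* u :* (w :* v :+ t)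
             := (con 1 :+ c :* w) :* (u :* v) :+ (s :+ c :* u :* t)) refl
             (f x′) (g y′ z′) (T′ x′ y′ z′) c (f x₀) (T′ x₀ y′ z′) ⟩
      (1# + c * f x₀) * (f x′ * g y′ z′) + reduce T′ x y z
        ≈⟨ +-congʳ (*-congʳ 1+cf≈0) ⟩
      0# * (f x′ * g y′ z′) + reduce T′ x y z
        ≈⟨ trans (+-congʳ (zeroˡ _)) (+-identityˡ _) ⟩
      reduce T′ x y z ∎
      where
      x′ = punchIn x₀ x
      y′ = punchIn x₀ y
      z′ = punchIn x₀ z
    -- The row T x₀ vanishes off the pivot, so the reduction changes no entry that survives punchIn.
    reduce≈ : ∀ x y z → reduce T x y z ≈ T (punchIn x₀ x) (punchIn x₀ y) (punchIn x₀ z)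
    reduce≈ x y z = trans (+-congˡ (trans (*-congˡ (off D _ _ _ λ (x₀≡y , _) → punchInᵢ≢i x₀ y (≡.sym x₀≡y))) (zeroʳ _)))
      (+-identityʳ _)
    reduced : Diagonal (reduce T)
    off reduced x y z neq = trans (reduce≈ x y z) (off D _ _ _ λ (p , q) →
      neq (punchIn-injective x₀ _ _ p , punchIn-injective x₀ _ _ q))
    on  reduced x eq = on D _ (trans (sym (reduce≈ x x x)) eq)

  -- Induction on the number of slices. One rotation brings the third axis to the first and two
  -- bring the second there, so elimination along the first axis suffices. With no slices left the
  -- tensor is zero and has no room for a non-zero diagonal entry.
  slice-rank : ∀ r → RankBound r
  slice-rank zero    {zero}  {[]} len (nil T≈0) D = z≤n
  slice-rank zero    {suc m} {[]} len (nil T≈0) D = ⊥-elim (on D zero (T≈0 _ _ _))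
  slice-rank (suc r) {L = (ax₁ , f) ∷ L} len s D = eliminate (slice-rank r) (ℕ.suc-injective len) s D
  slice-rank (suc r) {L = (ax₃ , f) ∷ L} len s D =
    eliminate (slice-rank r) (≡.trans (length-map _ L) (ℕ.suc-injective len)) (Span-rotate s) (rotate-Diagonal D)
  slice-rank (suc r) {L = (ax₂ , f) ∷ L} len s D =
    eliminate (slice-rank r)
      (≡.trans (length-map _ (List.map rotateAxis L)) (≡.trans (length-map _ L) (ℕ.suc-injective len)))
      (Span-rotate (Span-rotate s)) (rotate-Diagonal (rotate-Diagonal D))

-- Expansion of the product tensor into low-degree slices.

module Expansion {q : ℕ} (F : FiniteField q) where
  open Field F
  open SliceRank F
  open import Algebra.Properties.Semiring.Exp semiring using (_^_; ^-homo-*)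
  open import Relation.Binary.Reasoning.Setoid setoid

  -- Polynomials are kept as functions together with a finite sum decomposition; like terms are not
  -- collected, and only the shape `P` of each summand is recorded.
  data SumOf {I : Set} (P : (I → Carrier) → Set) : (I → Carrier) → Set where
    nil  : ∀ {f} → (∀ i → f i ≈ 0#) → SumOf P f
    cons : ∀ {f t g} → P t → SumOf P g → (∀ i → f i ≈ t i + g i) → SumOf P f

  module _ {I J K : Set} {P : (I → Carrier) → Set} {Q : (J → Carrier) → Set} {R : (K → Carrier) → Set}
           (α : K → I) (β : K → J) (_·_ : ∀ {s t} → P s → Q t → R (λ k → s (α k) * t (β k))) where

    -- The accumulator `h` carries the remaining products, so distributivity yields one flat sum.
    -- Through `α` and `β` the same expansion serves factors in common variables (both identities)
    -- and in separate ones (`heads` and `tails`).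
    SumOf-*ˡ : ∀ {s g h} → P s → SumOf Q g → SumOf R h → SumOf R (λ k → s (α k) * g (β k) + h k)
    SumOf-*ˡ {s} {g} {h} ps (nil g≈0) sh = resp sh
      where
      eq : ∀ k → s (α k) * g (β k) + h k ≈ h k
      eq k = trans (+-congʳ (trans (*-congˡ (g≈0 _)) (zeroʳ _))) (+-identityˡ _)
      resp : SumOf R h → SumOf R (λ k → s (α k) * g (β k) + h k)
      resp (nil h≈0)        = nil λ k → trans (eq k) (h≈0 k)
      resp (cons r sr h≈) = cons r sr λ k → trans (eq k) (h≈ k)
    SumOf-*ˡ ps (cons qt sg eq) sh = cons (ps · qt) (SumOf-*ˡ ps sg sh) λ k →
      trans (+-congʳ (trans (*-congˡ (eq _)) (distribˡ _ _ _))) (+-assoc _ _ _)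

    SumOf-* : ∀ {f g} → SumOf P f → SumOf Q g → SumOf R (λ k → f (α k) * g (β k))
    SumOf-* (nil f≈0) sg = nil λ k → trans (*-congʳ (f≈0 _)) (zeroˡ _)
    SumOf-* {f} {g} (cons {t = s} {g = f′} ps sf eq) sg = resp (SumOf-*ˡ ps sg (SumOf-* sf sg))
      where
      eq′ : ∀ k → f (α k) * g (β k) ≈ s (α k) * g (β k) + f′ (α k) * g (β k)
      eq′ k = trans (*-congʳ (eq _)) (distribʳ _ _ _)
      resp : SumOf R (λ k → s (α k) * g (β k) + f′ (α k) * g (β k)) → SumOf R (λ k → f (α k) * g (β k))
      resp (nil h≈0)      = nil λ k → trans (eq′ k) (h≈0 k)
      resp (cons r sr h≈) = cons r sr λ k → trans (eq′ k) (h≈ k)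

  Triple : Set → Set
  Triple X = X × X × X

  record Monomial (D : ℕ) (t : Triple Carrier → Carrier) : Set where
    field
      coeff   : Carrier
      i j k   : ℕ
      degree≤ : i ℕ.+ j ℕ.+ k ℕ.≤ D
      value   : ∀ a b c → t (a , b , c) ≈ coeff * (a ^ i * (b ^ j * c ^ k))

  Monomial-* : ∀ {D E s t} → Monomial D s → Monomial E t → Monomial (D ℕ.+ E) (λ v → s v * t v)
  Monomial-* {D} {E} {s} {t} m m′ = record
    { coeff   = M.coeff * M′.coeff
    ; i = M.i ℕ.+ M′.i ; j = M.j ℕ.+ M′.j ; k = M.k ℕ.+ M′.k
    ; degree≤ = ℕ.≤-trans (ℕ.≤-reflexive (lemma M.i M.j M.k M′.i M′.j M′.k)) (ℕ.+-mono-≤ M.degree≤ M′.degree≤)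
    ; value   = λ a b c → begin
        s (a , b , c) * t (a , b , c)
          ≈⟨ *-cong (M.value a b c) (M′.value a b c) ⟩
        (M.coeff * (a ^ M.i * (b ^ M.j * c ^ M.k))) * (M′.coeff * (a ^ M′.i * (b ^ M′.j * c ^ M′.k)))
          ≈⟨ solve 8 (λ x a b c x′ a′ b′ c′ → (x :* (a :* (b :* c))) :* (x′ :* (a′ :* (b′ :* c′)))
               := (x :* x′) :* ((a :* a′) :* ((b :* b′) :* (c :* c′)))) refl _ _ _ _ _ _ _ _ ⟩
        M.coeff * M′.coeff * ((a ^ M.i * a ^ M′.i) * ((b ^ M.j * b ^ M′.j) * (c ^ M.k * c ^ M′.k)))
          ≈⟨ *-congˡ (*-cong (^-homo-* a M.i _) (*-cong (^-homo-* b M.j _) (^-homo-* c M.k _))) ⟨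
        M.coeff * M′.coeff * (a ^ (M.i ℕ.+ M′.i) * (b ^ (M.j ℕ.+ M′.j) * c ^ (M.k ℕ.+ M′.k))) ∎
    }
    where
    module M  = Monomial m
    module M′ = Monomial m′
    lemma : ∀ a b c a′ b′ c′ → a ℕ.+ a′ ℕ.+ (b ℕ.+ b′) ℕ.+ (c ℕ.+ c′) ≡ a ℕ.+ b ℕ.+ c ℕ.+ (a′ ℕ.+ b′ ℕ.+ c′)
    lemma = solve-∀

  linear : ∀ e → SumOf (Monomial 1) (λ (a , b , c) → a + b + c + e)
  linear e = cons (mono 1# 1 0 0 (s≤s z≤n)) (cons (mono 1# 0 1 0 (s≤s z≤n)) (cons (mono 1# 0 0 1 (s≤s z≤n))
    (cons (mono e 0 0 0 z≤n) (nil {f = λ _ → 0#} λ _ → refl) λ _ → refl) λ _ → refl) λ _ → refl)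
    λ (a , b , c) → solve 4 (λ a b c e → a :+ b :+ c :+ e :=
      con 1 :* (a :* con 1 :* (con 1 :* con 1)) :+ (con 1 :* (con 1 :* (b :* con 1 :* con 1))
        :+ (con 1 :* (con 1 :* (con 1 :* (c :* con 1))) :+ (e :* (con 1 :* (con 1 :* con 1)) :+ con 0)))) refl a b c e
    where
    mono : ∀ x i j k → i ℕ.+ j ℕ.+ k ℕ.≤ 1 → Monomial 1 (λ (a , b , c) → x * (a ^ i * (b ^ j * c ^ k)))
    mono x i j k d = record { coeff = x ; i = i ; j = j ; k = k ; degree≤ = d ; value = λ _ _ _ → refl }

  rootProduct : List Carrier → Carrier → Carrier
  rootProduct []       t = 1#
  rootProduct (e ∷ es) t = (t + - e) * rootProduct es t

  rootProduct-expands : ∀ es → SumOf (Monomial (length es)) (λ (a , b , c) → rootProduct es (a + b + c))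
  rootProduct-expands []       = cons record { coeff = 1# ; i = 0 ; j = 0 ; k = 0 ; degree≤ = z≤n
    ; value = λ _ _ _ → refl } (nil {f = λ _ → 0#} λ _ → refl) λ _ → solve 0 (con 1 := con 1 :* (con 1 :* (con 1 :* con 1)) :+ con 0) refl
  rootProduct-expands (e ∷ es) = SumOf-* (λ v → v) (λ v → v) Monomial-* (linear (- e)) (rootProduct-expands es)

  rootProduct-root : ∀ {es t} → t ∈ es → rootProduct es t ≈ 0#
  rootProduct-root (here ≡.refl) = trans (*-congʳ (-‿inverseʳ _)) (zeroˡ _)
  rootProduct-root (there t∈)    = trans (*-congˡ (rootProduct-root t∈)) (zeroʳ _)

  rootProduct-≉0 : ∀ {es t} → ¬ (t ∈ es) → rootProduct es t ≉0
  rootProduct-≉0 {[]}         t∉ = 1≉0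
  rootProduct-≉0 {e ∷ es} {t} t∉ = *-≉0 (λ t-e≈0 → t∉ (here (≈-is-≡ (begin
    t                ≈⟨ +-identityʳ t ⟨
    t + 0#           ≈⟨ +-congˡ (-‿inverseˡ e) ⟨
    t + (- e + e)    ≈⟨ +-assoc t (- e) e ⟨
    t + - e + e      ≈⟨ +-congʳ t-e≈0 ⟩
    0# + e           ≈⟨ +-identityˡ e ⟩
    e                ∎)))) (rootProduct-≉0 {es} λ t∈ → t∉ (there t∈))

  units : List Carrier
  units = List.filter (λ x → ¬? (x ≟ 0#)) (List.tabulate (Inverse.to enum))

  ∈-elements : ∀ x → x ∈ List.tabulate (Inverse.to enum)
  ∈-elements x = ≡.subst (_∈ List.tabulate (Inverse.to enum)) (Inverse.strictlyInverseˡ enum x)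
    (∈-tabulate⁺ (Inverse.from enum x))

  -- Zero occurs among the q listed elements and is filtered out. This gives degree at most q - 1
  -- for the polynomial with these roots.
  length-units : length units ℕ.< q
  length-units = ≡.subst (length units ℕ.<_) (length-tabulate (Inverse.to enum))
    (filter-notAll (λ x → ¬? (x ≟ 0#)) _ (Any.map (λ { ≡.refl nz → nz ≡.refl }) (∈-elements 0#)))

  mono : ∀ {N} → Vec ℕ N → (Fin N → Carrier) → Carrier
  mono []      a = 1#
  mono (i ∷ e) a = a zero ^ i * mono e (a ∘ suc)

  -- The coordinatewise bounds place the exponent vectors in the box; the joint bound on the total
  -- degrees feeds the pigeonhole argument.
  record Term (B N : ℕ) (t : Triple (Fin N → Carrier) → Carrier) : Set where
    field
      coeff    : Carrier
      e₁ e₂ e₃ : Vec ℕ N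
      e₁≤ : All (ℕ._≤ B) e₁
      e₂≤ : All (ℕ._≤ B) e₂
      e₃≤ : All (ℕ._≤ B) e₃
      degree≤ : Vec.sum e₁ ℕ.+ Vec.sum e₂ ℕ.+ Vec.sum e₃ ℕ.≤ N ℕ.* B
      value : ∀ a b c → t (a , b , c) ≈ coeff * (mono e₁ a * (mono e₂ b * mono e₃ c))

  heads : ∀ {N} → Triple (Fin (suc N) → Carrier) → Triple Carrier
  heads (a , b , c) = a zero , b zero , c zero

  tails : ∀ {N} → Triple (Fin (suc N) → Carrier) → Triple (Fin N → Carrier)
  tails (a , b , c) = a ∘ suc , b ∘ suc , c ∘ suc

  Term-∷ : ∀ {B N s t} → Monomial B s → Term B N t → Term B (suc N) (λ v → s (heads v) * t (tails v))
  Term-∷ {B} {N} {s} {t} m u = record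
    { coeff = M.coeff * U.coeff
    ; e₁ = M.i ∷ U.e₁ ; e₂ = M.j ∷ U.e₂ ; e₃ = M.k ∷ U.e₃
    ; e₁≤ = ℕ.≤-trans (ℕ.≤-trans (ℕ.m≤m+n _ _) (ℕ.m≤m+n _ _)) M.degree≤ ∷ U.e₁≤
    ; e₂≤ = ℕ.≤-trans (ℕ.≤-trans (ℕ.m≤n+m M.j M.i) (ℕ.m≤m+n (M.i ℕ.+ M.j) M.k)) M.degree≤ ∷ U.e₂≤
    ; e₃≤ = ℕ.≤-trans (ℕ.m≤n+m _ _) M.degree≤ ∷ U.e₃≤
    ; degree≤ = ℕ.≤-trans (ℕ.≤-reflexive (lemma M.i M.j M.k (Vec.sum U.e₁) (Vec.sum U.e₂) (Vec.sum U.e₃)))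
        (ℕ.+-mono-≤ M.degree≤ U.degree≤)
    ; value = λ a b c → begin
        s (a zero , b zero , c zero) * t (a ∘ suc , b ∘ suc , c ∘ suc)
          ≈⟨ *-cong (M.value _ _ _) (U.value _ _ _) ⟩
        _ ≈⟨ solve 8 (λ x a b c x′ a′ b′ c′ → (x :* (a :* (b :* c))) :* (x′ :* (a′ :* (b′ :* c′)))
               := (x :* x′) :* ((a :* a′) :* ((b :* b′) :* (c :* c′)))) refl _ _ _ _ _ _ _ _ ⟩
        M.coeff * U.coeff * (mono (M.i ∷ U.e₁) a * (mono (M.j ∷ U.e₂) b * mono (M.k ∷ U.e₃) c)) ∎
    }
    where
    module M = Monomial m
    module U = Term u
    lemma : ∀ a b c a′ b′ c′ → a ℕ.+ a′ ℕ.+ (b ℕ.+ b′) ℕ.+ (c ℕ.+ c′) ≡ a ℕ.+ b ℕ.+ c ℕ.+ (a′ ℕ.+ b′ ℕ.+ c′)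
    lemma = solve-∀

  -- Each factor has exactly the non-zero field elements as roots, so the product is non-zero
  -- precisely when all coordinate sums vanish.
  zeroTest : ∀ {N} → Triple (Fin N → Carrier) → Carrier
  zeroTest {zero}  v = 1#
  zeroTest {suc N} v@(a , b , c) = rootProduct units (a zero + b zero + c zero) * zeroTest (tails v)

  zeroTest-expands : ∀ {B} → q ≡ suc B → ∀ N → SumOf (Term B N) zeroTest
  zeroTest-expands q≡ zero = cons record { coeff = 1# ; e₁ = [] ; e₂ = [] ; e₃ = [] ; e₁≤ = [] ; e₂≤ = [] ; e₃≤ = []
    ; degree≤ = z≤n ; value = λ _ _ _ → refl } (nil {f = λ _ → 0#} λ _ → refl)
    λ _ → solve 0 (con 1 := con 1 :* (con 1 :* (con 1 :* con 1)) :+ con 0) refl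
  zeroTest-expands {B} q≡ (suc N) = SumOf-* heads tails (λ m → Term-∷ (weaken m))
    (rootProduct-expands units) (zeroTest-expands q≡ N)
    where
    -- As q = B + 1, the strict bound `length units < q` is the degree bound `B`.
    weaken : ∀ {t} → Monomial (length units) t → Monomial B t
    weaken m = record { Monomial m ; degree≤ = ℕ.≤-trans (Monomial.degree≤ m)
      (ℕ.s≤s⁻¹ (≡.subst (length units ℕ.<_) q≡ length-units)) }

  zeroTest-≉0⁺ : ∀ {N} (a b c : Fin N → Carrier) → (∀ i → a i + b i + c i ≈ 0#) → zeroTest (a , b , c) ≉0
  zeroTest-≉0⁺ {zero}  a b c ≈0 = 1≉0
  zeroTest-≉0⁺ {suc N} a b c ≈0 = *-≉0
    (≡.subst (λ t → rootProduct units t ≉0) (≡.sym (≈-is-≡ (≈0 zero)))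
      (rootProduct-≉0 λ 0∈ → proj₂ (∈-filter⁻ (λ x → ¬? (x ≟ 0#)) {xs = List.tabulate (Inverse.to enum)} 0∈) ≡.refl))
    (zeroTest-≉0⁺ (a ∘ suc) (b ∘ suc) (c ∘ suc) (≈0 ∘ suc))

  zeroTest-≉0⁻ : ∀ {N} (a b c : Fin N → Carrier) → zeroTest (a , b , c) ≉0 → ∀ i → a i + b i + c i ≈ 0#
  zeroTest-≉0⁻ {suc N} a b c T≉0 zero with (a zero + b zero + c zero) ≟ 0#
  ... | yes eq = ≡-is-≈ eq
  ... | no neq = ⊥-elim (T≉0 (trans (*-congʳ (rootProduct-root
    (∈-filter⁺ (λ x → ¬? (x ≟ 0#)) (∈-elements _) neq))) (zeroˡ _)))
  zeroTest-≉0⁻ {suc N} a b c T≉0 (suc i) = zeroTest-≉0⁻ (a ∘ suc) (b ∘ suc) (c ∘ suc)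
    (λ eq → T≉0 (trans (*-congˡ eq) (zeroʳ _))) i

  -- Were 3x, 3y and 3z all above `M`, their sum would exceed 3M.
  some-third : ∀ x y z M → x ℕ.+ y ℕ.+ z ℕ.≤ M → 3 ℕ.* x ℕ.≤ M ⊎ 3 ℕ.* y ℕ.≤ M ⊎ 3 ℕ.* z ℕ.≤ M
  some-third x y z M x+y+z≤M with 3 ℕ.* x ℕ.≤? M | 3 ℕ.* y ℕ.≤? M | 3 ℕ.* z ℕ.≤? M
  ... | yes p | _     | _     = inj₁ p
  ... | no _  | yes p | _     = inj₂ (inj₁ p)
  ... | no _  | no _  | yes p = inj₂ (inj₂ p)
  ... | no p  | no p′ | no p″ = ⊥-elim (ℕ.<-irrefl ≡.refl (ℕ.<-≤-trans
    (ℕ.+-mono-< (ℕ.+-mono-< (ℕ.≰⇒> p) (ℕ.≰⇒> p′)) (ℕ.≰⇒> p″))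
    (ℕ.≤-trans (ℕ.≤-reflexive (lemma x y z)) (ℕ.≤-trans (ℕ.*-monoʳ-≤ 3 x+y+z≤M) (ℕ.≤-reflexive (lemma′ M))))))
    where
    lemma : ∀ x y z → 3 ℕ.* x ℕ.+ 3 ℕ.* y ℕ.+ 3 ℕ.* z ≡ 3 ℕ.* (x ℕ.+ y ℕ.+ z)
    lemma = solve-∀
    lemma′ : ∀ M → 3 ℕ.* M ≡ M ℕ.+ M ℕ.+ M
    lemma′ = solve-∀

  module _ {X : Set} {N : ℕ} (B : ℕ) (a b c : X → Fin N → Carrier) where

    axisSlices : Axis → (X → Fin N → Carrier) → List (Axis × (X → Carrier))
    axisSlices d u = List.map (λ e → d , (λ x → mono e (u x))) (low B N)

    lowSlices : List (Axis × (X → Carrier))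
    lowSlices = axisSlices ax₁ a ++ axisSlices ax₂ b ++ axisSlices ax₃ c

    length-lowSlices : length lowSlices ≡ 3 ℕ.* length (low B N)
    length-lowSlices = ≡.trans (length-++ (axisSlices ax₁ a)) (≡.cong₂ ℕ._+_ (length-map _ (low B N))
      (≡.trans (length-++ (axisSlices ax₂ b)) (≡.cong₂ ℕ._+_ (length-map _ (low B N))
        (≡.trans (length-map _ (low B N)) (≡.sym (ℕ.+-identityʳ _))))))

    -- A low exponent vector supplies the one-variable factor; the coefficient and the other two
    -- monomials form the cofactor. All terms thus share one list of slices.
    Term-span : ∀ {t} → Term B N t → Span lowSlices (λ x y z → t (a x , b y , c z))
    Term-span u with some-third (Vec.sum (Term.e₁ u)) (Vec.sum (Term.e₂ u)) (Vec.sum (Term.e₃ u)) (N ℕ.* B) (Term.degree≤ u)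
    ... | inj₁ l = Span-resp (λ x y z → trans (Term.value u _ _ _)
            (solve 4 (λ k p q r → k :* (p :* (q :* r)) := p :* (k :* (q :* r))) refl _ _ _ _))
            (Span-slice (∈-++⁺ˡ (∈-map⁺ _ (∈-low⁺ (Term.e₁≤ u) l)))
              (λ y z → Term.coeff u * (mono (Term.e₂ u) (b y) * mono (Term.e₃ u) (c z))))
    ... | inj₂ (inj₁ l) = Span-resp (λ x y z → trans (Term.value u _ _ _)
            (solve 4 (λ k p q r → k :* (p :* (q :* r)) := q :* (k :* (p :* r))) refl _ _ _ _))
            (Span-slice (∈-++⁺ʳ (axisSlices ax₁ a) (∈-++⁺ˡ (∈-map⁺ _ (∈-low⁺ (Term.e₂≤ u) l))))
              (λ z x → Term.coeff u * (mono (Term.e₁ u) (a x) * mono (Term.e₃ u) (c z))))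
    ... | inj₂ (inj₂ l) = Span-resp (λ x y z → trans (Term.value u _ _ _)
            (solve 4 (λ k p q r → k :* (p :* (q :* r)) := r :* (k :* (p :* q))) refl _ _ _ _))
            (Span-slice (∈-++⁺ʳ (axisSlices ax₁ a) (∈-++⁺ʳ (axisSlices ax₂ b) (∈-map⁺ _ (∈-low⁺ (Term.e₃≤ u) l))))
              (λ x y → Term.coeff u * (mono (Term.e₁ u) (a x) * mono (Term.e₂ u) (b y))))

    SumOf-span : ∀ {f} → SumOf (Term B N) f → Span lowSlices (λ x y z → f (a x , b y , c z))
    SumOf-span (nil f≈0)      = Span-0 lowSlices λ _ _ _ → f≈0 _
    SumOf-span (cons u s f≈) = Span-resp (λ _ _ _ → f≈ _) (Span-+ (Term-span u) (SumOf-span s))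

  -- The bound for tricoloured sum-free sets: the zero test is a tensor on the indices, diagonal by
  -- `free`, with non-zero diagonal by `diag`, so its size is at most the number of slices.
  sumFree-bound : ∀ {B m N} → q ≡ suc B → (a b c : Fin m → Fin N → Carrier) →
    (∀ x i → a x i + b x i + c x i ≈ 0#) →
    (∀ x y z → (∀ i → a x i + b y i + c z i ≈ 0#) → x ≡ y × y ≡ z) →
    m ℕ.≤ 3 ℕ.* length (low B N)
  sumFree-bound {B} {m} {N} q≡ a b c diag free =
    ≡.subst (m ℕ.≤_) (length-lowSlices B a b c)
      (slice-rank _ ≡.refl (SumOf-span B a b c (zeroTest-expands q≡ N)) record
        { off = off
        ; on  = λ x → zeroTest-≉0⁺ (a x) (b x) (c x) (diag x) })
    where
    off : ∀ x y z → ¬ (x ≡ y × y ≡ z) → zeroTest (a x , b y , c z) ≈ 0#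
    off x y z neq with zeroTest (a x , b y , c z) ≈0?
    ... | yes eq = eq
    ... | no T≉0 = ⊥-elim (neq (free x y z (zeroTest-≉0⁻ (a x) (b y) (c z) T≉0)))

-- From pattern-free sets to tricoloured sum-free sets.

lookup-injective : ∀ {A : Set} {xs : List A} → Unique xs → ∀ i j → List.lookup xs i ≡ List.lookup xs j → i ≡ j
lookup-injective (_ ∷ _)   zero    zero    _  = ≡.refl
lookup-injective (x∉ ∷ _)  zero    (suc j) eq = ⊥-elim (ListAll.lookup x∉ (∈-lookup j) eq)
lookup-injective (x∉ ∷ _)  (suc i) zero    eq = ⊥-elim (ListAll.lookup x∉ (∈-lookup i) (≡.sym eq))
lookup-injective (_ ∷ uni) (suc i) (suc j) eq = ≡.cong suc (lookup-injective uni i j eq)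

module Pattern {q : ℕ} (F : FiniteField q) where
  open Field F
  open FieldOps F
  open Expansion F using (sumFree-bound)
  open import Algebra.Properties.Semiring.Sum semiring
    using (sum; sum-cong-≋; ∑-distrib-+; ∑-comm; *-distribˡ-sum; *-distribʳ-sum)
  open import Algebra.Properties.Ring ring using (-‿distribʳ-*; -‿distribˡ-*; -0#≈0#)
  open import Algebra.Properties.AbelianGroup +-abelianGroup using () renaming (⁻¹-∙-comm to -‿+-comm)
  open import Relation.Binary.Reasoning.Setoid setoid

  Column : ℕ → Set
  Column k = Fin k → Carrier

  infixr 8 _·_
  _·_ : ∀ {k} → Mat k → Column k → Column k
  (M · v) j = Σ[ _ ] (λ s → M j s * v s)

  infixl 6 _−_
  _−_ : ∀ {k} → Column k → Column k → Column k
  (u − v) s = u s + - v s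

  -- Bridge to the library sum, which brings distributivity and the exchange of two summations.
  Σ≈sum : ∀ k (f : Fin k → Carrier) → Σ[ k ] f ≈ sum f
  Σ≈sum zero    f = refl
  Σ≈sum (suc k) f = +-congˡ (Σ≈sum k (f ∘ suc))

  Σ-cong : ∀ k {f g : Fin k → Carrier} → (∀ s → f s ≈ g s) → Σ[ k ] f ≈ Σ[ k ] g
  Σ-cong k {f} {g} f≈g = trans (Σ≈sum k f) (trans (sum-cong-≋ f≈g) (sym (Σ≈sum k g)))

  Σ-+ : ∀ k (f g : Fin k → Carrier) → Σ[ k ] (λ s → f s + g s) ≈ Σ[ k ] f + Σ[ k ] g
  Σ-+ k f g = trans (Σ≈sum k _) (trans (∑-distrib-+ f g) (sym (+-cong (Σ≈sum k f) (Σ≈sum k g))))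

  Σ-≈0 : ∀ {k} {f : Fin k → Carrier} → (∀ s → f s ≈ 0#) → Σ[ k ] f ≈ 0#
  Σ-≈0 {zero}  f≈0 = refl
  Σ-≈0 {suc k} f≈0 = trans (+-cong (f≈0 zero) (Σ-≈0 (f≈0 ∘ suc))) (+-identityˡ 0#)

  Σ-single : ∀ {k} {f : Fin k → Carrier} j → (∀ s → ¬ (j ≡ s) → f s ≈ 0#) → Σ[ k ] f ≈ f j
  Σ-single zero    f≈0 = trans (+-congˡ (Σ-≈0 λ s → f≈0 (suc s) λ ())) (+-identityʳ _)
  Σ-single (suc j) f≈0 = trans (+-cong (f≈0 zero λ ()) (Σ-single j λ s j≢s → f≈0 (suc s) λ { ≡.refl → j≢s ≡.refl }))
    (+-identityˡ _)

  ·-cong : ∀ {k} (M : Mat k) {u v : Column k} → (∀ s → u s ≈ v s) → ∀ j → (M · u) j ≈ (M · v) j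
  ·-cong M u≈v j = Σ-cong _ λ s → *-congˡ (u≈v s)

  ·-≈0 : ∀ {k} (M : Mat k) {u : Column k} → (∀ s → u s ≈ 0#) → ∀ j → (M · u) j ≈ 0#
  ·-≈0 M u≈0 j = Σ-≈0 λ s → trans (*-congˡ (u≈0 s)) (zeroʳ _)

  Σ-neg : ∀ k (f : Fin k → Carrier) → Σ[ k ] (λ s → - f s) ≈ - Σ[ k ] f
  Σ-neg zero    f = sym -0#≈0#
  Σ-neg (suc k) f = trans (+-congˡ (Σ-neg k (f ∘ suc))) (-‿+-comm _ _)

  ·-− : ∀ {k} (M : Mat k) u v j → (M · (u − v)) j ≈ (M · u − M · v) j
  ·-− {k} M u v j = begin
    Σ[ _ ] (λ s → M j s * (u s + - v s))             ≈⟨ Σ-cong k (λ s → trans (distribˡ _ _ _) (+-congˡ (sym (-‿distribʳ-* (M j s) (v s))))) ⟩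
    Σ[ _ ] (λ s → M j s * u s + - (M j s * v s))     ≈⟨ Σ-+ k _ _ ⟩
    (M · u) j + Σ[ _ ] (λ s → - (M j s * v s))       ≈⟨ +-congˡ (Σ-neg k _) ⟩
    (M · u) j + - (M · v) j                          ∎

  ⊖-· : ∀ {k} (M N : Mat k) v j → ((M ⊖ N) · v) j ≈ (M · v − N · v) j
  ⊖-· {k} M N v j = begin
    Σ[ _ ] (λ s → (M j s + - N j s) * v s)           ≈⟨ Σ-cong k (λ s → trans (distribʳ _ _ _) (+-congˡ (sym (-‿distribˡ-* (N j s) (v s))))) ⟩
    Σ[ _ ] (λ s → M j s * v s + - (N j s * v s))     ≈⟨ Σ-+ k _ _ ⟩
    (M · v) j + Σ[ _ ] (λ s → - (N j s * v s))       ≈⟨ +-congˡ (Σ-neg k _) ⟩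
    (M · v) j + - (N · v) j                          ∎

  ⊗-· : ∀ {k} (M N : Mat k) v j → (M · N · v) j ≈ ((M ⊗ N) · v) j
  ⊗-· {k} M N v j = begin
    Σ[ k ] (λ s → M j s * Σ[ k ] (λ t → N s t * v t))
      ≈⟨ trans (Σ≈sum k _) (sum-cong-≋ λ s → trans (*-congˡ (Σ≈sum k _)) (*-distribˡ-sum (M j s) λ t → N s t * v t)) ⟩
    sum (λ s → sum λ t → M j s * (N s t * v t))
      ≈⟨ ∑-comm (λ s t → M j s * (N s t * v t)) ⟩
    sum (λ t → sum λ s → M j s * (N s t * v t))
      ≈⟨ sum-cong-≋ (λ t → sum-cong-≋ λ s → *-assoc (M j s) (N s t) (v t)) ⟨
    sum (λ t → sum λ s → M j s * N s t * v t)
      ≈⟨ sum-cong-≋ (λ t → *-distribʳ-sum (v t) λ s → M j s * N s t) ⟨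
    sum (λ t → sum (λ s → M j s * N s t) * v t)
      ≈⟨ trans (Σ≈sum k _) (sum-cong-≋ λ t → *-congʳ (Σ≈sum k λ s → M j s * N s t)) ⟨
    Σ[ k ] (λ t → Σ[ k ] (λ s → M j s * N s t) * v t) ∎

  idMat-diag : ∀ {k} (j : Fin k) → idMat k j j ≈ 1#
  idMat-diag j with j Fin.≟ j
  ... | yes _ = refl
  ... | no ¬p = ⊥-elim (¬p ≡.refl)

  idMat-off : ∀ {k} {i j : Fin k} → ¬ (i ≡ j) → idMat k i j ≈ 0#
  idMat-off {i = i} {j} i≢j with i Fin.≟ j
  ... | yes p = ⊥-elim (i≢j p)
  ... | no _  = refl

  idMat-· : ∀ {k} (v : Column k) j → (idMat k · v) j ≈ v j
  idMat-· v j = trans (Σ-single j λ s j≢s → trans (*-congʳ (idMat-off j≢s)) (zeroˡ _))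
    (trans (*-congʳ (idMat-diag j)) (*-identityˡ _))

  ·-inverse : ∀ {k} (M N : Mat k) → (∀ i j → (M ⊗ N) i j ≡ idMat k i j) → ∀ v j → (M · N · v) j ≈ v j
  ·-inverse M N MN≡1 v j = trans (⊗-· M N v j)
    (trans (Σ-cong _ λ s → *-congʳ (≡-is-≈ (MN≡1 j s))) (idMat-· v j))

  -- A matrix mixes the k vectors of a point but acts on each of the n coordinates separately; read
  -- as n columns, a point undergoes ordinary matrix-vector products.
  column : ∀ {n k} → Point n k → Fin n → Column k
  column x t s = lookup (lookup x s) t

  fromColumns : ∀ {n k} → (Fin n → Column k) → Point n k
  fromColumns f = tabulate λ s → tabulate λ t → f t s

  column-fromColumns : ∀ {n k} (f : Fin n → Column k) t s → column (fromColumns f) t s ≡ f t s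
  column-fromColumns f t s = ≡.trans (≡.cong (λ r → lookup r t) (lookup∘tabulate _ s)) (lookup∘tabulate _ t)

  fromColumns-column : ∀ {n k} (x : Point n k) → fromColumns (column x) ≡ x
  fromColumns-column x = ≡.trans (tabulate-cong λ s → tabulate∘lookup (lookup x s)) (tabulate∘lookup x)

  Point-ext : ∀ {n k} {x y : Point n k} → (∀ t s → column x t s ≈ column y t s) → x ≡ y
  Point-ext {x = x} {y} x≈y = ≡.trans (≡.sym (fromColumns-column x))
    (≡.trans (tabulate-cong λ s → tabulate-cong λ t → ≈-is-≡ (x≈y t s)) (fromColumns-column y))

  column-⊕-act : ∀ {n k} (x : Point n k) (M : Mat k) (f : Fin n → Column k) t s →
                 column (x ⊕ act M (fromColumns f)) t s ≈ column x t s + (M · f t) s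
  column-⊕-act x M f t s = trans (≡-is-≈ (≡.trans
      (≡.cong (λ r → lookup r t) (lookup-zipWith (Vec.zipWith _+_) s x (act M (fromColumns f))))
      (≡.trans (lookup-zipWith _+_ t (lookup x s) _)
        (≡.cong (column x t s +_) (column-fromColumns (λ t → M · column (fromColumns f) t) t s)))))
    (+-congˡ (Σ-cong _ λ r → *-congˡ (≡-is-≈ (column-fromColumns f t r))))

  _≟ᴾ_ : ∀ {n k} (x y : Point n k) → Dec (x ≡ y)
  _≟ᴾ_ = ≡-dec (≡-dec _≟_)

  a+[b-a]≈b : ∀ a b → a + (b + - a) ≈ b
  a+[b-a]≈b a b = begin
    a + (b + - a)  ≈⟨ solve 3 (λ a b c → a :+ (b :+ c) := b :+ (a :+ c)) refl a b (- a) ⟩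
    b + (a + - a)  ≈⟨ +-congˡ (-‿inverseʳ a) ⟩
    b + 0#         ≈⟨ +-identityʳ b ⟩
    b              ∎

  module _ {n k : ℕ} {M₁ M₂ : Mat k} (inv₁ : Invertible M₁) (inv₂ : Invertible M₂) (inv₃ : Invertible (M₁ ⊖ M₂)) where
    private
      N₁ = proj₁ inv₁
      N₂ = proj₁ inv₂
      N₃ = proj₁ inv₃

    α β γ : Point n k → Fin n → Column k
    α x t = N₂ · column x t − N₁ · column x t
    β y t = N₁ · column y t
    γ z t s = - (N₂ · column z t) s

    sum-zero : ∀ x t s → α x t s + β x t s + γ x t s ≈ 0#
    sum-zero x t s = begin
      p₂ + - p₁ + p₁ + - p₂      ≈⟨ solve 4 (λ p₂ n₁ p₁ n₂ → p₂ :+ n₁ :+ p₁ :+ n₂ := (p₂ :+ n₂) :+ (n₁ :+ p₁)) refl p₂ (- p₁) p₁ (- p₂) ⟩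
      p₂ + - p₂ + (- p₁ + p₁)    ≈⟨ +-cong (-‿inverseʳ p₂) (-‿inverseˡ p₁) ⟩
      0# + 0#                    ≈⟨ +-identityˡ 0# ⟩
      0#                         ∎
      where
      p₁ = (N₁ · column x t) s
      p₂ = (N₂ · column x t) s

    module _ (x y z : Point n k) (sum≈0 : ∀ t s → α x t s + β y t s + γ z t s ≈ 0#) where

      -- The candidate for the difference d, obtained by solving y = x + M₁ d.
      D : Fin n → Column k
      D t = N₁ · (column y t − column x t)

      -- The relation N₂x - N₁x + N₁y - N₂z = 0 rearranges to N₁(y - x) = N₂(z - x), so the same d
      -- also solves z = x + M₂ d.
      D≈ : ∀ t s → D t s ≈ (N₂ · (column z t − column x t)) s
      D≈ t s = begin
        D t s                                ≈⟨ ·-− N₁ _ _ s ⟩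
        y₁ + - x₁                            ≈⟨ +-identityʳ _ ⟨
        -- The semiring solver treats negated terms as atoms, so the pairs that cancel are inserted
        -- as explicit zeros.
        y₁ + - x₁ + 0#                       ≈⟨ +-congˡ (trans (+-cong (-‿inverseʳ x₂) (-‿inverseʳ z₂)) (+-identityˡ 0#)) ⟨
        y₁ + - x₁ + (x₂ + - x₂ + (z₂ + - z₂))
          ≈⟨ solve 6 (λ y₁ nx₁ x₂ nx₂ z₂ nz₂ → y₁ :+ nx₁ :+ (x₂ :+ nx₂ :+ (z₂ :+ nz₂))
               := (z₂ :+ nx₂) :+ (x₂ :+ nx₁ :+ y₁ :+ nz₂)) refl y₁ (- x₁) x₂ (- x₂) z₂ (- z₂) ⟩
        z₂ + - x₂ + (x₂ + - x₁ + y₁ + - z₂)  ≈⟨ +-congˡ (sum≈0 t s) ⟩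
        z₂ + - x₂ + 0#                       ≈⟨ +-identityʳ _ ⟩
        z₂ + - x₂                            ≈⟨ ·-− N₂ _ _ s ⟨
        (N₂ · (column z t − column x t)) s   ∎
        where
        x₁ = (N₁ · column x t) s
        x₂ = (N₂ · column x t) s
        y₁ = (N₁ · column y t) s
        z₂ = (N₂ · column z t) s

      M₁D≈ : ∀ t s → (M₁ · D t) s ≈ (column y t − column x t) s
      M₁D≈ t = ·-inverse M₁ N₁ (proj₁ (proj₂ inv₁)) _

      M₂D≈ : ∀ t s → (M₂ · D t) s ≈ (column z t − column x t) s
      M₂D≈ t s = trans (·-cong M₂ (D≈ t) s) (·-inverse M₂ N₂ (proj₁ (proj₂ inv₂)) _ s)

      y≡ : y ≡ x ⊕ act M₁ (fromColumns D)
      y≡ = Point-ext λ t s → sym (trans (column-⊕-act x M₁ D t s) (trans (+-congˡ (M₁D≈ t s)) (a+[b-a]≈b _ _)))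

      z≡ : z ≡ x ⊕ act M₂ (fromColumns D)
      z≡ = Point-ext λ t s → sym (trans (column-⊕-act x M₂ D t s) (trans (+-congˡ (M₂D≈ t s)) (a+[b-a]≈b _ _)))

      D≈0⇒ : (∀ t s → D t s ≈ 0#) → x ≡ y × y ≡ z
      D≈0⇒ D≈0 = x≡y , ≡.trans (≡.sym x≡y) x≡z
        where
        stays : ∀ M → x ≡ x ⊕ act M (fromColumns D)
        stays M = Point-ext λ t s → sym (trans (column-⊕-act x M D t s)
          (trans (+-congˡ (·-≈0 M (D≈0 t) s)) (+-identityʳ _)))
        x≡y = ≡.trans (stays M₁) (≡.sym y≡)
        x≡z = ≡.trans (stays M₂) (≡.sym z≡)

      x≡y⇒D≈0 : x ≡ y → ∀ t s → D t s ≈ 0#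
      x≡y⇒D≈0 ≡.refl t = ·-≈0 N₁ λ s → -‿inverseʳ _

      x≡z⇒D≈0 : x ≡ z → ∀ t s → D t s ≈ 0#
      x≡z⇒D≈0 ≡.refl t s = trans (D≈ t s) (·-≈0 N₂ (λ s → -‿inverseʳ _) s)

      -- Here (M₁ - M₂) D = y - z = 0, and `N₃` inverts M₁ - M₂.
      y≡z⇒D≈0 : y ≡ z → ∀ t s → D t s ≈ 0#
      y≡z⇒D≈0 ≡.refl t s = trans (sym (·-inverse N₃ (M₁ ⊖ M₂) (proj₂ (proj₂ inv₃)) (D t) s))
        (·-≈0 N₃ (λ r → trans (⊖-· M₁ M₂ (D t) r)
          (trans (+-congʳ (trans (M₁D≈ t r) (sym (M₂D≈ t r)))) (-‿inverseʳ _))) s)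

      -- The points have the form x, x + M₁ D, x + M₂ D, so two of them agree, for otherwise they
      -- would be a forbidden pattern. Any one coincidence forces D = 0, and then all three agree.
      coincide : ∀ {A} → PatternFree M₁ M₂ A → x ∈ A → y ∈ A → z ∈ A → x ≡ y × y ≡ z
      coincide {A} free x∈ y∈ z∈ with x ≟ᴾ y | x ≟ᴾ z | y ≟ᴾ z
      ... | yes p | _     | _     = D≈0⇒ (x≡y⇒D≈0 p)
      ... | no _  | yes p | _     = D≈0⇒ (x≡z⇒D≈0 p)
      ... | no _  | no _  | yes p = D≈0⇒ (y≡z⇒D≈0 p)
      ... | no x≢y | no x≢z | no y≢z = ⊥-elim (free x (fromColumns D)
        ( x∈ , ≡.subst (_∈ A) y≡ y∈ , ≡.subst (_∈ A) z≡ z∈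
        , (λ eq → x≢y (≡.trans eq (≡.sym y≡))) , (λ eq → x≢z (≡.trans eq (≡.sym z≡)))
        , λ eq → y≢z (≡.trans y≡ (≡.trans eq (≡.sym z≡))) ))

    patternFree-bound : ∀ {B} → q ≡ suc B → (A : List (Point n k)) → Unique A → PatternFree M₁ M₂ A →
                        length A ℕ.≤ 3 ℕ.* length (low B (k ℕ.* n))
    patternFree-bound q≡ A unique free = sumFree-bound q≡ (flatten α) (flatten β) (flatten γ)
      (λ x i → sum-zero (point x) _ _)
      λ x y z sum≈0 →
        let x≡y , y≡z = coincide (point x) (point y) (point z) (unflatten x y z sum≈0) free
                          (∈-lookup x) (∈-lookup y) (∈-lookup z)
        in lookup-injective unique x y x≡y , lookup-injective unique y z y≡z
      where
      point : Fin (length A) → Point n k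
      point = List.lookup A
      at : (Fin n → Column k) → Fin k × Fin n → Carrier
      at f (s , t) = f t s
      -- The tensor argument expects a single index range, so the pairs of row and coordinate are
      -- numbered by `Fin (k * n)`.
      flatten : (Point n k → Fin n → Column k) → Fin (length A) → Fin (k ℕ.* n) → Carrier
      flatten f x i = at (f (point x)) (remQuot n i)
      unflatten : ∀ x y z → (∀ i → flatten α x i + flatten β y i + flatten γ z i ≈ 0#) →
                  ∀ t s → α (point x) t s + β (point y) t s + γ (point z) t s ≈ 0#
      unflatten x y z sum≈0 t s = ≡.subst
        (λ st → at (α (point x)) st + at (β (point y)) st + at (γ (point z)) st ≈ 0#)
        (remQuot-combine s t) (sum≈0 (combine s t))

-- Odd prime powers as 2h + 1 with h ≥ 1.

halve : ∀ n → ∃ λ j → n ≡ j ℕ.+ j ⊎ n ≡ suc (j ℕ.+ j)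
halve zero = 0 , inj₁ ≡.refl
halve (suc n) with halve n
... | j , inj₁ eq = j , inj₂ (≡.cong suc eq)
... | j , inj₂ eq = suc j , inj₁ (≡.cong suc (≡.trans eq (≡.sym (ℕ.+-suc j j))))

odd-prime : ∀ {p} → Prime p → ¬ (p ≡ 2) → ∃ λ j → 1 ℕ.≤ j × p ≡ suc (j ℕ.+ j)
odd-prime {p} pr p≢2 with halve p
... | zero  , inj₂ ≡.refl = ⊥-elim (¬prime[1] pr)
... | suc j , inj₂ eq     = suc j , s≤s z≤n , eq
... | j , inj₁ eq with prime⇒irreducible pr (divides j (≡.trans eq (lemma j)))
  where
  lemma : ∀ j → j ℕ.+ j ≡ j ℕ.* 2
  lemma = solve-∀
...   | inj₂ 2≡p = ⊥-elim (p≢2 (≡.sym 2≡p))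

odd-power : ∀ j m → ∃ λ h → suc (j ℕ.+ j) ℕ.^ m ≡ suc (h ℕ.+ h)
odd-power j zero = 0 , ≡.refl
odd-power j (suc m) with odd-power j m
... | h , eq = j ℕ.* suc (h ℕ.+ h) ℕ.+ h , ≡.trans (≡.cong (suc (j ℕ.+ j) ℕ.*_) eq) (lemma j h)
  where
  lemma : ∀ j h → suc (j ℕ.+ j) ℕ.* suc (h ℕ.+ h) ≡ suc (j ℕ.* suc (h ℕ.+ h) ℕ.+ h ℕ.+ (j ℕ.* suc (h ℕ.+ h) ℕ.+ h))
  lemma = solve-∀

oddPrimePower⇒odd : ∀ {q} → OddPrimePower q → ∃ λ h → 1 ℕ.≤ h × q ≡ suc (h ℕ.+ h)
oddPrimePower⇒odd (p , suc m , pr , p≢2 , _ , ≡.refl) with odd-prime pr p≢2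
... | j , 1≤j , ≡.refl with odd-power j (suc m)
...   | suc h , eq = suc h , s≤s z≤n , eq
-- The value h = 0 would make the prime power 1, yet it is at least p > 1.
...   | zero  , eq = ⊥-elim (ℕ.<-irrefl (≡.sym eq) (ℕ.≤-trans (s≤s (ℕ.≤-trans 1≤j (ℕ.m≤m+n j j)))
          (ℕ.≤-trans (ℕ.≤-reflexive (≡.sym (ℕ.^-identityʳ _))) (ℕ.^-monoʳ-≤ (suc (j ℕ.+ j)) (s≤s (z≤n {m}))))))

-- Passage to the rationals and the final estimate.

open import Data.Nat using (_*_; _≥_)
open import Data.Integer using (+_)
open import Data.Rational using (ℚ; _/_; _≤_)
import Data.Integer as ℤ
import Data.Integer.Properties as ℤ
import Data.Rational as ℚ
import Data.Rational.Properties as ℚ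
import Data.Rational.Unnormalised as ℚᵘ
import Data.Rational.Unnormalised.Properties as ℚᵘ
open import Algebra.Bundles using (CommutativeMonoid)
open import Algebra.Properties.CommutativeSemigroup (CommutativeMonoid.commutativeSemigroup ℚ.*-1-commutativeMonoid) using (interchange)

ι : ℕ → ℚ
ι n = + n / 1

-- Reduction to lowest terms does not compute on variables, so the identity is checked on
-- unnormalised fractions.
ι-* : ∀ m n → ι (m * n) ≡ ι m ℚ.* ι n
ι-* m n = ℚ.toℚᵘ-injective (ℚᵘ.≃-trans (ℚ.toℚᵘ-fromℚᵘ (ℚᵘ.mkℚᵘ (+ (m * n)) 0))
  (ℚᵘ.≃-trans (ℚᵘ.*≡* (≡.cong (ℤ._* + 1) (ℤ.pos-* m n)))
  (ℚᵘ.≃-sym (ℚᵘ.≃-trans (ℚ.toℚᵘ-homo-* (ι m) (ι n))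
    (ℚᵘ.*-cong (ℚ.toℚᵘ-fromℚᵘ (ℚᵘ.mkℚᵘ (+ m) 0)) (ℚ.toℚᵘ-fromℚᵘ (ℚᵘ.mkℚᵘ (+ n) 0)))))))

ι-mono-≤ : ∀ {m n} → m ℕ.≤ n → ι m ≤ ι n
ι-mono-≤ {m} {n} m≤n = ℚ.toℚᵘ-cancel-≤ (ℚᵘ.≤-respˡ-≃ (ℚᵘ.≃-sym (ℚ.toℚᵘ-fromℚᵘ (ℚᵘ.mkℚᵘ (+ m) 0)))
  (ℚᵘ.≤-respʳ-≃ (ℚᵘ.≃-sym (ℚ.toℚᵘ-fromℚᵘ (ℚᵘ.mkℚᵘ (+ n) 0)))
    (ℚᵘ.*≤* (ℤ.*-monoʳ-≤-nonNeg (+ 1) (ℤ.+≤+ m≤n)))))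

ι-^ : ∀ m N → ι (m ℕ.^ N) ≡ ι m ^ℚ N
ι-^ m zero    = ≡.refl
ι-^ m (suc N) = ≡.trans (ι-* m (m ℕ.^ N)) (≡.cong (ι m ℚ.*_) (ι-^ m N))

^ℚ-distrib-* : ∀ p q N → (p ℚ.* q) ^ℚ N ≡ (p ^ℚ N) ℚ.* (q ^ℚ N)
^ℚ-distrib-* p q zero    = ≡.sym (ℚ.*-identityˡ ℚ.1ℚ)
^ℚ-distrib-* p q (suc N) = ≡.trans (≡.cong ((p ℚ.* q) ℚ.*_) (^ℚ-distrib-* p q N))
  (interchange p q (p ^ℚ N) (q ^ℚ N))

Positive-^ℚ : ∀ p → .⦃ ℚ.Positive p ⦄ → ∀ N → ℚ.Positive (p ^ℚ N)
Positive-^ℚ p zero    = _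
Positive-^ℚ p (suc N) = ℚ.pos*pos⇒pos p (p ^ℚ N) ⦃ Positive-^ℚ p N ⦄

-- Multiplication by `10000 ^ N` reduces the claim to natural numbers; this positive factor is then
-- cancelled.
bound-in-ℚ : ∀ a l q N → a ℕ.≤ 3 * l → l * 10000 ℕ.^ N ℕ.≤ (9184 * q) ℕ.^ N →
  ι a ≤ ι 3 ℚ.* (((+ 9184 / 10000) ℚ.* ι q) ^ℚ N)
bound-in-ℚ a l q N a≤3l l≤ = ℚ.*-cancelʳ-≤-pos (ι 10000 ^ℚ N) ⦃ Positive-^ℚ (ι 10000) N ⦄ (begin
  ι a ℚ.* (ι 10000 ^ℚ N)                        ≡⟨ ≡.cong (ι a ℚ.*_) (ι-^ 10000 N) ⟨
  ι a ℚ.* ι (10000 ℕ.^ N)                       ≡⟨ ι-* a (10000 ℕ.^ N) ⟨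
  ι (a * 10000 ℕ.^ N)                           ≤⟨ ι-mono-≤ natural ⟩
  ι (3 * (9184 * q) ℕ.^ N)                      ≡⟨ ι-* 3 ((9184 * q) ℕ.^ N) ⟩
  ι 3 ℚ.* ι ((9184 * q) ℕ.^ N)                  ≡⟨ ≡.cong (ι 3 ℚ.*_) (ι-^ (9184 * q) N) ⟩
  ι 3 ℚ.* (ι (9184 * q) ^ℚ N)                   ≡⟨ ≡.cong (λ t → ι 3 ℚ.* (t ^ℚ N)) scaled ⟩
  ι 3 ℚ.* ((c ℚ.* ι 10000) ^ℚ N)                ≡⟨ ≡.cong (ι 3 ℚ.*_) (^ℚ-distrib-* c (ι 10000) N) ⟩
  ι 3 ℚ.* ((c ^ℚ N) ℚ.* (ι 10000 ^ℚ N))         ≡⟨ ℚ.*-assoc (ι 3) (c ^ℚ N) (ι 10000 ^ℚ N) ⟨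
  ι 3 ℚ.* (c ^ℚ N) ℚ.* (ι 10000 ^ℚ N)           ∎)
  where
  open ℚ.≤-Reasoning
  c = (+ 9184 / 10000) ℚ.* ι q
  natural : a * 10000 ℕ.^ N ℕ.≤ 3 * (9184 * q) ℕ.^ N
  natural = ℕ.≤-trans (ℕ.*-monoˡ-≤ (10000 ℕ.^ N) a≤3l)
    (ℕ.≤-trans (ℕ.≤-reflexive (ℕ.*-assoc 3 l _)) (ℕ.*-monoʳ-≤ 3 l≤))
  scaled : ι (9184 * q) ≡ c ℚ.* ι 10000
  scaled = ≡.trans (ι-* 9184 q) (≡.trans (≡.cong (ℚ._* ι q) 9184≡)
    (≡.trans (ℚ.*-assoc (+ 9184 / 10000) (ι 10000) (ι q))
      (≡.trans (≡.cong ((+ 9184 / 10000) ℚ.*_) (ℚ.*-comm (ι 10000) (ι q)))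
        (≡.sym (ℚ.*-assoc (+ 9184 / 10000) (ι q) (ι 10000))))))
    where
    9184≡ : ι 9184 ≡ (+ 9184 / 10000) ℚ.* ι 10000
    9184≡ = ≡.refl

ι-NonNegative : ∀ n → ℚ.NonNegative (ι n)
ι-NonNegative n = ℚ.nonNegative (ι-mono-≤ {0} {n} ℕ.z≤n)

mainTheorem1 : (q : ℕ) → OddPrimePower q →
    Σ ℚ λ c →
    ((+ 8414 / 10000) Data.Rational.* (+ q / 1) ≤ c) ×
    (c ≤ (+ 9184 / 10000) Data.Rational.* (+ q / 1)) ×
    ((F : FiniteField q) → let open FieldOps F in
    (n k : ℕ) → n ≥ 1 → k ≥ 1 →
    (M₁ M₂ : Mat k) →
    Invertible M₁ → Invertible M₂ → Invertible (M₁ ⊖ M₂) →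
    (A : List (Point n k)) → Unique A → PatternFree M₁ M₂ A →
    (+ length A / 1) ≤ (+ 3 / 1) Data.Rational.* (c ^ℚ (k * n)))
mainTheorem1 q opp =
  -- With the upper endpoint as the constant, the upper bound is reflexivity and the lower one is
  -- 0.8414 ≤ 0.9184 scaled by q.
  (+ 9184 / 10000) ℚ.* ι q ,
  ℚ.*-monoʳ-≤-nonNeg (ι q) ⦃ ι-NonNegative q ⦄ (ℚ.≤ᵇ⇒≤ {+ 8414 / 10000} {+ 9184 / 10000} _) ,
  ℚ.≤-refl ,
  λ F n k _ _ M₁ M₂ inv₁ inv₂ inv₃ A unique free →
    let h , 1≤h , q≡ = oddPrimePower⇒odd opp in
    bound-in-ℚ (length A) (length (low (h ℕ.+ h) (k * n))) q (k * n)
      (Pattern.patternFree-bound F inv₁ inv₂ inv₃ q≡ A unique free)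
      (≡.subst (λ q → length (low (h ℕ.+ h) (k * n)) * 10000 ℕ.^ (k * n) ℕ.≤ (9184 * q) ℕ.^ (k * n))
        (≡.sym q≡) (low-count h 1≤h (k * n)))
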